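{- Let $m>n$ be coprime positive integers with $m\not\equiv n \pmod 2$, and set $a=m^2-n^2$, $b=2mn$, $c=m^2+n^2$. If $$ m > \max\{10^{109948},\ n^{(\log n)^{3/2}}\}, $$ then the equation $a^x+b^y=c^z$ has no solution in positive integers $(x,y,z)\neq(2,2,2)$ with $x\equiv y\equiv z\equiv 0 \pmod 2$.
   Context: Here $\log$ denotes the natural logarithm. -}

module Defs where

open import Algebra.Definitions.RawSemiring using (_^_; sum)
open import Data.Integer.Base using (+_; -[1+_])
open import Data.Fin.Base using (Fin; zero; suc; toℕ)
open import Data.Nat.Base as ℕ using (ℕ; zero; suc; NonZero)
open import Data.Product.Base using (∃-syntax; _×_; _,_)
open import Data.Rational hiding (positive; NonZero)
open import Data.Rational.Properties
open import Data.Sum.Base using (inj₁; inj₂)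
open import Relation.Binary.PropositionalEquality.Core using (_≡_; refl; sym; subst)
open import Relation.Unary using (Pred; _∈_; _∩_; Satisfiable)
open import Level using (0ℓ)

infixr 8 _^ℚ_
_^ℚ_ : ℚ → ℕ → ℚ
_^ℚ_ = _^_ +-*-rawSemiring

∑ : ∀ {n} → (Fin n → ℚ) → ℚ
∑ = sum +-*-rawSemiring

-- A nonnegative real x is a (right) Dedekind cut: `upper` is the set of the
-- rationals q with x < q.

record ℝ≥0 : Set₁ where
  field
    upper     : Pred ℚ 0ℓ
    inhabited : Satisfiable upper
    positive  : ∀ {q} → q ∈ upper → 0ℚ < q
    closed    : ∀ {q r} → q ∈ upper → q < r → r ∈ upper
    rounded   : ∀ {r} → r ∈ upper → ∃[ q ] q < r × q ∈ upper

open ℝ≥0 public using (upper)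

-- x < y when a rational q satisfies x < q ≤ y; here q ≤ y is expressed by
-- saying that q lies strictly below every rational r > y.

infix 4 _<ℝ_
_<ℝ_ : ℝ≥0 → ℝ≥0 → Set
x <ℝ y = ∃[ q ] q ∈ upper x × (∀ {r} → r ∈ upper y → q < r)

inf : (S : Pred ℚ 0ℓ) → Satisfiable S → (∀ {s} → s ∈ S → 0ℚ ≤ s) → ℝ≥0
inf S (s , s∈S) nonneg = record
  { upper     = λ r → ∃[ s ] s ∈ S × s < r
  ; inhabited = s + 1ℚ , s , s∈S , s<s+1
  ; positive  = λ (_ , t∈S , t<q) → ≤-<-trans (nonneg t∈S) t<q
  ; closed    = λ (t , t∈S , t<q) q<r → t , t∈S , <-trans t<q q<r
  ; rounded   = λ (t , t∈S , t<r) → let (q , t<q , q<r) = <-dense t<r in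
                  q , q<r , t , t∈S , t<q
  }
  where
  s<s+1 : s < s + 1ℚ
  s<s+1 = subst (_< s + 1ℚ) (+-identityʳ s) (+-monoʳ-< s (positive⁻¹ 1ℚ))

infixl 6 _⊔ℝ_
_⊔ℝ_ : ℝ≥0 → ℝ≥0 → ℝ≥0
x ⊔ℝ y = record
  { upper     = upper x ∩ upper y
  ; inhabited = inh X.inhabited Y.inhabited
  ; positive  = λ (q∈x , _) → X.positive q∈x
  ; closed    = λ (q∈x , q∈y) q<r → X.closed q∈x q<r , Y.closed q∈y q<r
  ; rounded   = λ (r∈x , r∈y) → rnd (X.rounded r∈x) (Y.rounded r∈y)
  }
  where
  module X = ℝ≥0 x
  module Y = ℝ≥0 y

  up : ∀ (z : ℝ≥0) {q r} → q ∈ upper z → q ≤ r → r ∈ upper z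
  up z q∈z q≤r = let (_ , p<q , p∈z) = ℝ≥0.rounded z q∈z in
    ℝ≥0.closed z p∈z (<-≤-trans p<q q≤r)

  inh : Satisfiable X.upper → Satisfiable Y.upper → Satisfiable (X.upper ∩ Y.upper)
  inh (p , p∈x) (q , q∈y) = p ⊔ q , up x p∈x (p≤p⊔q p q) , up y q∈y (p≤q⊔p p q)

  rnd : ∀ {r} → (∃[ p ] p < r × p ∈ X.upper) → (∃[ q ] q < r × q ∈ Y.upper) →
        ∃[ t ] t < r × t ∈ (X.upper ∩ Y.upper)
  rnd (p , p<r , p∈x) (q , q<r , q∈y) with ≤-total p q
  ... | inj₁ p≤q = q , q<r , up x p∈x p≤q , q∈y
  ... | inj₂ q≤p = p , p<r , p∈x , up y q∈y q≤p

0≤+/ : ∀ p q .{{_ : NonZero q}} → 0ℚ ≤ + p / q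
0≤+/ p q = nonNegative⁻¹ (+ p / q) {{normalize-nonNeg p q}}

fromℕ : ℕ → ℝ≥0
fromℕ n = inf (λ s → s ≡ + n / 1) (+ n / 1 , refl) λ { refl → 0≤+/ n 1 }

-- The natural logarithm log n = ∫₁ⁿ dt/t, as the infimum of the upper Darboux
-- sums over the uniform partitions of [1, n] with mesh 1/k, where k = suc l.
-- The partition points are 1 + i/k, and the i-th summand is
-- (1/k) · 1/(1 + i/k) = 1/(k + i).

darboux : ℕ → ℕ → ℚ
darboux n l = ∑ {(n ℕ.∸ 1) ℕ.* suc l} λ i → + 1 / (suc l ℕ.+ toℕ i)

0≤∑ : ∀ {n} (f : Fin n → ℚ) → (∀ i → 0ℚ ≤ f i) → 0ℚ ≤ ∑ f
0≤∑ {zero}  f 0≤f = ≤-refl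
0≤∑ {suc n} f 0≤f =
  +-mono-≤ (0≤f zero) (0≤∑ (λ i → f (suc i)) (λ i → 0≤f (suc i)))

log : (n : ℕ) .{{_ : NonZero n}} → ℝ≥0
log n = inf (λ s → ∃[ l ] s ≡ darboux n l) (darboux n 0 , 0 , refl)
  λ { (l , refl) → 0≤∑ {(n ℕ.∸ 1) ℕ.* suc l} _ λ i → 0≤+/ 1 (suc l ℕ.+ toℕ i) }

0≤^ℚ : ∀ {u} → 0ℚ ≤ u → ∀ n → 0ℚ ≤ u ^ℚ n
0≤^ℚ         0≤u zero    = nonNegative⁻¹ 1ℚ
0≤^ℚ {u = u} 0≤u (suc n) = nonNegative⁻¹ (u * u ^ℚ n)
  {{nonNeg*nonNeg⇒nonNeg u {{nonNegative 0≤u}} (u ^ℚ n) {{nonNegative (0≤^ℚ 0≤u n)}}}}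

1≤^ℚ : ∀ {s} → 1ℚ ≤ s → ∀ n → 1ℚ ≤ s ^ℚ n
≤^ℚ  : ∀ {s} → 1ℚ ≤ s → ∀ n → s ≤ s ^ℚ suc n

1≤^ℚ 1≤s zero    = ≤-refl
1≤^ℚ 1≤s (suc n) = ≤-trans 1≤s (≤^ℚ 1≤s n)

≤^ℚ {s} 1≤s n = subst (_≤ s ^ℚ suc n) (*-identityʳ s)
  (*-monoˡ-≤-nonNeg s {{nonNegative (≤-trans (nonNegative⁻¹ 1ℚ) 1≤s)}} (1≤^ℚ 1≤s n))

-- The rational power x^(p/q): the infimum of the s ≥ 0 with u^p ≤ s^q for
-- some rational u > x.

infixr 8 _^⟨_/_⟩
_^⟨_/_⟩ : ℝ≥0 → (p q : ℕ) .{{_ : NonZero q}} → ℝ≥0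
x ^⟨ p / q@(suc q-1) ⟩ =
  inf (λ s → 0ℚ ≤ s × ∃[ u ] u ∈ upper x × u ^ℚ p ≤ s ^ℚ q) (nonempty X.inhabited)
    λ (0≤s , _) → 0≤s
  where
  module X = ℝ≥0 x

  nonempty : Satisfiable (upper x) →
             ∃[ s ] 0ℚ ≤ s × ∃[ u ] u ∈ upper x × u ^ℚ p ≤ s ^ℚ q
  nonempty (u , u∈x) =
    s , ≤-trans 0≤w w≤s , u , u∈x , ≤-trans w≤s (≤^ℚ 1≤s q-1)
    where
    w s : ℚ
    w = u ^ℚ p
    s = 1ℚ ⊔ w

    0≤w : 0ℚ ≤ w
    0≤w = 0≤^ℚ (<⇒≤ (X.positive u∈x)) p

    w≤s : w ≤ s
    w≤s = p≤q⊔p 1ℚ w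

    1≤s : 1ℚ ≤ s
    1≤s = p≤p⊔q 1ℚ w

-- The real power n^σ: the infimum of the rational powers n^(p/q) with p/q > σ.
-- This is correct because n ≥ 1 makes n^t nondecreasing in t.

infixr 8 _^ℝ_
_^ℝ_ : (n : ℕ) .{{_ : NonZero n}} → ℝ≥0 → ℝ≥0
n ^ℝ σ = inf S (nonempty Σ.inhabited)
    λ (p , q-1 , _ , s∈) → <⇒≤ (ℝ≥0.positive (fromℕ n ^⟨ p / suc q-1 ⟩) s∈)
  where
  module Σ = ℝ≥0 σ

  S : Pred ℚ 0ℓ
  S s = ∃[ p ] ∃[ q-1 ] + p / suc q-1 ∈ upper σ × s ∈ upper (fromℕ n ^⟨ p / suc q-1 ⟩)

  nonempty : Satisfiable (upper σ) → Satisfiable S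
  nonempty (t@(mkℚ (+ p) d _) , t∈σ) =
    let (s , s∈) = ℝ≥0.inhabited (fromℕ n ^⟨ p / suc d ⟩) in
    s , p , d , subst (_∈ upper σ) (sym (↥p/↧p≡p t)) t∈σ , s∈
  nonempty (t@(mkℚ -[1+ _ ] _ _) , t∈σ) with Σ.positive t∈σ
  ... | *<* ()

module Submission where

open import Defs
open import Data.Nat hiding (_/_)
open import Data.Nat.Properties
open import Data.Nat.Coprimality as Coprimality using (Coprime)
open import Data.Nat.Divisibility
open import Data.Nat.DivMod using (m<n⇒m%n≡m; [m+kn]%n≡m%n; m*n%n≡0)
open import Data.Nat.GCD
open import Data.Nat.Induction using (<-wellFounded)
open import Data.Nat.Tactic.RingSolver using (solve-∀)
open import Induction.WellFounded using (Acc; acc)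
import Data.Nat as ℕ
import Data.Nat.Properties as ℕP
open import Data.Integer as ℤ using () renaming (+_ to pos)
import Data.Integer.Properties as ℤP
open import Data.Rational as ℚ using (ℚ; 0ℚ; 1ℚ; ½; _/_; nonNegative; positive)
import Data.Rational.Properties as ℚP
open import Data.Rational.Unnormalised using (mkℚᵘ; *≤*; *<*; *≡*)
import Data.Rational.Unnormalised.Properties as ℚᵘP
open import Data.Fin.Base using (Fin; toℕ) renaming (zero to fzero; suc to fsuc)
open import Data.Product using (∃-syntax; _×_; _,_; proj₁; proj₂)
open import Data.Sum using (_⊎_; inj₁; inj₂)
open import Data.Unit using (tt)
open import Data.Empty using (⊥; ⊥-elim)
open import Relation.Nullary using (¬_; yes; no)
open import Relation.Binary.PropositionalEquality

-- Write x = 2X, y = 2Y, z = 2Z. The coprime factors of (c^Z - b^Y)(c^Z + b^Y) = a^2X are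
-- odd 2X-th powers whose difference 2b^Y is divisible by 4^Y, so lifting the exponent at 2
-- gives 4^Y ≤ a²X. Comparing sizes, Z < 2Y and X < 4Y, so Y < 3 log₂ m; then c^Z ≤ 2a^Z
-- yields X ≤ Z. If Y = 1, this forces X = Z = 1. If Y ≥ 2, the equation multiplied by c^2X,
-- read modulo m⁴, gives n^(4Z+4X) + 2(Z+X) n^(4Z+4X-2) m² ≡ n^8X. If X = Z or n = 1, then
-- m² ∣ 2(Z+X), which is too small. Otherwise m² < n^4(Z-X), so Z - X is large, and therefore
-- c^Z - b^Y < m^Y. In the binomial expansion of c^Z = (m² + n²)^Z the terms not visibly
-- divisible by m^Y also sum to less than m^Y (here log m ≫ (log n)² enters), so this sum
-- equals c^Z - b^Y. It is a multiple of n, while c^Z - b^Y divides a^2X and a is prime to n.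

-- Size comparisons bound X and Z only in terms of Y; an absolute bound must come from arithmetic. A
-- difference of 2X-th powers has few factors 2 unless a or X is large, whereas b^Y contains 4^Y
-- because mn is even. Modulo m⁴ the term b^2Y vanishes as soon as Y ≥ 2, and multiplying by c^2X
-- turns a^2X into a power of ac = m⁴ - n⁴, hence into a pure power of n; on the left only the term
-- linear in m² survives beside a power of n.
--
-- All sizes are measured in bits: k and M are the binary logarithms of n and m, rounded down, and
-- the hypothesis enters as k ≤ √M / 2. The critical estimate concerns the remainder of the binomial
-- expansion. It involves roughly 3k / 2 factors Zn², where Z < 2^λ₀ and λ₀ is about √M / 8, so its
-- exponent of 2 is about (1/8 + 1)√M · (3/4)√M = (27/32)M, which stays below M. The 3 comes from Y
-- < 3M; λ₀ need only be small against √M with 2^λ₀ above 6M.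

1≤2 : 1 ≤ 2
1≤2 = s≤s z≤n

1≤^ : ∀ {b} → 1 ≤ b → ∀ e → 1 ≤ b ^ e
1≤^ {b} 1≤b e = subst (_≤ b ^ e) (^-zeroˡ e) (^-monoˡ-≤ e 1≤b)

^-monoʳ : ∀ {b e f} → 1 ≤ b → e ≤ f → b ^ e ≤ b ^ f
^-monoʳ {b} 1≤b = ^-monoʳ-≤ b {{>-nonZero 1≤b}}

^-distribʳ-* : ∀ e b d → (b * d) ^ e ≡ b ^ e * d ^ e
^-distribʳ-* zero    b d = refl
^-distribʳ-* (suc e) b d =
  trans (cong (b * d *_) (^-distribʳ-* e b d)) (lemma b d (b ^ e) (d ^ e))
  where
  lemma : ∀ b d x y → b * d * (x * y) ≡ b * x * (d * y)
  lemma = solve-∀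

^-double : ∀ b e → b ^ (2 * e) ≡ b ^ e * b ^ e
^-double b e = trans (cong (b ^_) (cong (e +_) (+-identityʳ e))) (^-distribˡ-+-* b e e)

^-cancelʳ-< : ∀ {b} e f → 1 ≤ b → b ^ e < b ^ f → e < f
^-cancelʳ-< e f 1≤b lt with e <? f
... | yes e<f = e<f
... | no  e≮f = ⊥-elim (<⇒≱ lt (^-monoʳ 1≤b (≮⇒≥ e≮f)))

-- When x grows by one, the bracketing index stays or moves to its successor, since `f` is strictly
-- increasing. Instances are an integer logarithm and an integer square root.
bracket : ∀ (f : ℕ → ℕ) → (∀ l → f l < f (suc l)) → ∀ x → f 0 ≤ x →
  ∃[ l ] f l ≤ x × x < f (suc l)
bracket f inc zero    f0≤x = 0 , f0≤x , ≤-<-trans z≤n (inc 0)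
bracket f inc (suc x) f0≤x with f 0 ≤? x
... | no  f0≰x = 0 , f0≤x , ≤-<-trans (≰⇒> f0≰x) (inc 0)
... | yes f0≤x′ with bracket f inc x f0≤x′
... | l , lo , hi with suc x <? f (suc l)
... | yes lt = l , m≤n⇒m≤1+n lo , lt
... | no  ≮  = suc l , ≮⇒≥ ≮ , ≤-<-trans hi (inc (suc l))

floor-log₂ : ∀ x → 1 ≤ x → ∃[ e ] 2 ^ e ≤ x × x < 2 ^ suc e
floor-log₂ = bracket (2 ^_) (λ e → ^-monoʳ-< 2 ≤-refl (n<1+n e))

-- Coprime factors of perfect powers

coprime-* : ∀ {d x y} → Coprime d x → Coprime d y → Coprime d (x * y)
coprime-* dx dy (e∣d , e∣xy) =
  dy (e∣d , Coprimality.coprime-divisor (λ (f∣e , f∣x) → dx (∣-trans f∣e e∣d , f∣x)) e∣xy)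

coprime-^ : ∀ {d x} → Coprime d x → ∀ e → Coprime d (x ^ e)
coprime-^ dx zero    = Coprimality.sym (Coprimality.1-coprimeTo _)
coprime-^ dx (suc e) = coprime-* dx (coprime-^ dx e)

coprime-∣ : ∀ {d x y} → y ∣ x → Coprime d x → Coprime d y
coprime-∣ y∣x dx (e∣d , e∣y) = dx (e∣d , ∣-trans e∣y y∣x)

^-mono-∣ : ∀ {x y} e → x ∣ y → x ^ e ∣ y ^ e
^-mono-∣ zero    _   = ∣-refl
^-mono-∣ (suc e) x∣y = *-pres-∣ x∣y (^-mono-∣ e x∣y)

∣*⇒∣gcd* : ∀ {d} x y → d ∣ x * y → d ∣ gcd d x * y
∣*⇒∣gcd* {d} x y d∣xy = subst (d ∣_) eq (gcd-greatest (n∣m*n y) (subst (d ∣_) (*-comm x y) d∣xy))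
  where
  eq : gcd (y * d) (y * x) ≡ gcd d x * y
  eq = trans (sym (c*gcd[m,n]≡gcd[cm,cn] y d x)) (*-comm y (gcd d x))

-- The factors w are replaced by gcd d w one at a time; `s` collects those already replaced.
∣^⇒∣gcd^ : ∀ {d} s w e → d ∣ s * w ^ e → d ∣ s * gcd d w ^ e
∣^⇒∣gcd^         s w zero    d∣ = d∣
∣^⇒∣gcd^ {d = d} s w (suc e) d∣ = subst (d ∣_) (*-assoc s g (g ^ e)) (∣^⇒∣gcd^ (s * g) w e
  (subst (d ∣_) (shuffle g s (w ^ e)) (∣*⇒∣gcd* w (s * w ^ e)
    (subst (d ∣_) (swap s w (w ^ e)) d∣))))
  where
  g = gcd d w
  swap : ∀ x y z → x * (y * z) ≡ y * (x * z)
  swap = solve-∀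
  shuffle : ∀ x y z → x * (y * z) ≡ y * x * z
  shuffle = solve-∀

-- For u ∣ g^e every w is replaced by the gcd; conversely g^e divides uv and is coprime to v. Naming
-- the root as a gcd keeps it visible that it divides w.
coprime-factor-of-power : ∀ {u v} w e → Coprime u v → u * v ≡ w ^ e → u ≡ gcd u w ^ e
coprime-factor-of-power {u} {v} w e cop eq = ∣-antisym u∣gᵉ gᵉ∣u
  where
  g = gcd u w
  u∣gᵉ : u ∣ g ^ e
  u∣gᵉ = subst (u ∣_) (*-identityˡ (g ^ e)) (∣^⇒∣gcd^ 1 w e
    (subst (u ∣_) (trans eq (sym (*-identityˡ (w ^ e)))) (m∣m*n v)))
  gᵉ∣vu : g ^ e ∣ v * u
  gᵉ∣vu = subst (g ^ e ∣_) (trans (sym eq) (*-comm u v)) (^-mono-∣ e (gcd[m,n]∣n u w))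
  gᵉ∣u : g ^ e ∣ u
  gᵉ∣u = Coprimality.coprime-divisor
    (Coprimality.sym (coprime-^ (coprime-∣ (gcd[m,n]∣m u w) (Coprimality.sym cop)) e)) gᵉ∣vu

-- Bernoulli's inequality and the tail of the binomial expansion

[p+q]^z*p≤ : ∀ p q z → (p + q) ^ z * p ≤ p ^ suc z + z * q * (p + q) ^ z
[p+q]^z*p≤ p q zero    = ≤-reflexive (lemma p)
  where
  lemma : ∀ p → 1 * p ≡ p * 1 + 0
  lemma = solve-∀
[p+q]^z*p≤ p q (suc z) = begin
  (p + q) * C * p                               ≡⟨ *-assoc (p + q) C p ⟩
  (p + q) * (C * p)                             ≤⟨ *-monoʳ-≤ (p + q) ([p+q]^z*p≤ p q z) ⟩
  (p + q) * (P + z * q * C)                     ≡⟨ lemma₁ p q z P C ⟩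
  p * P + z * q * ((p + q) * C) + q * P         ≤⟨ +-monoʳ-≤ _ (*-monoʳ-≤ q (^-monoˡ-≤ (suc z) (m≤m+n p q))) ⟩
  p * P + z * q * ((p + q) * C) + q * ((p + q) * C) ≡⟨ lemma₂ (p * P) q z ((p + q) * C) ⟩
  p * P + suc z * q * ((p + q) * C)             ∎
  where
  open ≤-Reasoning
  C = (p + q) ^ z
  P = p ^ suc z
  lemma₁ : ∀ p q z P C → (p + q) * (P + z * q * C) ≡ p * P + z * q * ((p + q) * C) + q * P
  lemma₁ = solve-∀
  lemma₂ : ∀ r q z C → r + z * q * C + q * C ≡ r + (1 + z) * q * C
  lemma₂ = solve-∀

-- The preceding inequality is Bernoulli's, (p / (p + q))^z ≥ 1 - zq / p, cleared of denominators;
-- here zq / p ≤ 1/2.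
[p+q]^z≤2p^z : ∀ p q z → 1 ≤ p → 2 * z * q ≤ p → (p + q) ^ z ≤ 2 * p ^ z
[p+q]^z≤2p^z p q z 1≤p 2zq≤p = *-cancelʳ-≤ C (2 * p ^ z) p {{>-nonZero 1≤p}}
  (+-cancelʳ-≤ (p * C) (C * p) (2 * p ^ z * p) (begin
  C * p + p * C             ≡⟨ lemma₁ C p ⟩
  2 * (C * p)               ≤⟨ *-monoʳ-≤ 2 ([p+q]^z*p≤ p q z) ⟩
  2 * (p * p ^ z + z * q * C) ≡⟨ lemma₂ p (p ^ z) z q C ⟩
  2 * p ^ z * p + 2 * z * q * C ≤⟨ +-monoʳ-≤ _ (*-monoˡ-≤ C 2zq≤p) ⟩
  2 * p ^ z * p + p * C ∎))
  where
  open ≤-Reasoning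
  C = (p + q) ^ z
  lemma₁ : ∀ C p → C * p + p * C ≡ 2 * (C * p)
  lemma₁ = solve-∀
  lemma₂ : ∀ p P z q C → 2 * (p * P + z * q * C) ≡ 2 * P * p + 2 * z * q * C
  lemma₂ = solve-∀

-- A monomial x^u y^v of degree Z = i + j - 1 has u ≥ i or v ≥ j; `Q` collects the first kind, `R`
-- the second. A coefficient in `R` satisfies binomial(Z, v) ≤ Z^j binomial(Z - j, v - j), so R ≤
-- Z^j (x + y)^(i - 1). The factor x in the bound avoids the exponent i - 1.
binomial-tail : ∀ x y i j →
  ∃[ Q ] ∃[ R ] (x + y) ^ pred (i + j) ≡ x ^ i * Q + y ^ j * R
              × x * R ≤ pred (i + j) ^ j * (x + y) ^ i
binomial-tail x y zero    j       = (x + y) ^ pred j , 0 ,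
  lemma ((x + y) ^ pred j) (y ^ j) , subst (_≤ pred j ^ j * 1) (sym (*-zeroʳ x)) z≤n
  where
  lemma : ∀ C Y → C ≡ 1 * C + Y * 0
  lemma = solve-∀
binomial-tail x y (suc i) zero    rewrite +-identityʳ i = 0 , (x + y) ^ i ,
  lemma (x * x ^ i) ((x + y) ^ i) ,
  ≤-trans (*-monoˡ-≤ _ (m≤m+n x y)) (≤-reflexive (sym (*-identityˡ _)))
  where
  lemma : ∀ C Y → Y ≡ C * 0 + 1 * Y
  lemma = solve-∀
binomial-tail x y (suc i) (suc j)
  with binomial-tail x y i (suc j) | binomial-tail x y (suc i) j
... | Q , R , eq , le | Q′ , R′ , eq′ , le′ rewrite +-suc i j =
  Q + y * Q′ , x * R + R′ , eqn , bound
  where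
  Z = i + j
  split : ∀ x y X Y Q Q′ R R′ →
    x * (X * Q + y * Y * R) + y * (x * X * Q′ + Y * R′) ≡ x * X * (Q + y * Q′) + y * Y * (x * R + R′)
  split = solve-∀
  eqn : (x + y) * (x + y) ^ Z ≡ x * x ^ i * (Q + y * Q′) + y * y ^ j * (x * R + R′)
  eqn = trans (*-distribʳ-+ ((x + y) ^ Z) x y)
    (trans (cong₂ (λ u v → x * u + y * v) eq eq′) (split x y (x ^ i) (y ^ j) Q Q′ R R′))
  open ≤-Reasoning
  regroup : ∀ x c Z z C → x * (Z * z * C) + z * (c * C) ≡ z * (Z * x + c) * C
  regroup = solve-∀
  regroup′ : ∀ c Z z C → z * (Z * c + c) * C ≡ (1 + Z) * z * (c * C)
  regroup′ = solve-∀
  bound : x * (x * R + R′) ≤ suc Z ^ suc j * (x + y) ^ suc i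
  bound = begin
    x * (x * R + R′)                             ≡⟨ *-distribˡ-+ x (x * R) R′ ⟩
    x * (x * R) + x * R′                         ≤⟨ +-mono-≤ (*-monoʳ-≤ x le) le′ ⟩
    x * (Z * Z ^ j * (x + y) ^ i) + Z ^ j * ((x + y) * (x + y) ^ i)
                                                 ≡⟨ regroup x (x + y) Z (Z ^ j) ((x + y) ^ i) ⟩
    Z ^ j * (Z * x + (x + y)) * (x + y) ^ i
      ≤⟨ *-monoˡ-≤ _ (*-monoʳ-≤ (Z ^ j) (+-monoˡ-≤ (x + y) (*-monoʳ-≤ Z (m≤m+n x y)))) ⟩
    Z ^ j * (Z * (x + y) + (x + y)) * (x + y) ^ i
                                                 ≡⟨ regroup′ (x + y) Z (Z ^ j) ((x + y) ^ i) ⟩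
    suc Z * Z ^ j * ((x + y) * (x + y) ^ i)
      ≤⟨ *-monoˡ-≤ ((x + y) ^ suc i) (*-monoʳ-≤ (suc Z) (^-monoˡ-≤ j (n≤1+n Z))) ⟩
    suc Z ^ suc j * (x + y) ^ suc i              ∎

-- Parity and lifting the exponent at 2

even-or-odd : ∀ n → (∃[ t ] n ≡ 2 * t) ⊎ (∃[ t ] n ≡ 1 + 2 * t)
even-or-odd zero    = inj₁ (0 , refl)
even-or-odd (suc n) with even-or-odd n
... | inj₁ (t , eq) = inj₂ (t , cong suc eq)
... | inj₂ (t , eq) = inj₁ (suc t , trans (cong suc eq) (lemma t))
  where
  lemma : ∀ t → 2 + 2 * t ≡ 2 * (1 + t)
  lemma = solve-∀

odd-* : ∀ {x y} → (∃[ s ] x ≡ 1 + 2 * s) → (∃[ t ] y ≡ 1 + 2 * t) → ∃[ u ] x * y ≡ 1 + 2 * u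
odd-* (s , refl) (t , refl) = s + t + 2 * s * t , lemma s t
  where
  lemma : ∀ s t → (1 + 2 * s) * (1 + 2 * t) ≡ 1 + 2 * (s + t + 2 * s * t)
  lemma = solve-∀

odd-^ : ∀ {x} → (∃[ s ] x ≡ 1 + 2 * s) → ∀ e → ∃[ t ] x ^ e ≡ 1 + 2 * t
odd-^ o zero    = 0 , refl
odd-^ o (suc e) = odd-* o (odd-^ o e)

coprime-2-odd : ∀ t → Coprime 2 (1 + 2 * t)
coprime-2-odd t {e} (e∣2 , e∣o) =
  ∣1⇒≡1 (∣m+n∣m⇒∣n (subst (e ∣_) (+-comm 1 (2 * t)) e∣o) (∣m⇒∣m*n t e∣2))

coprime-2^-odd : ∀ {x} → (∃[ s ] x ≡ 1 + 2 * s) → ∀ e → Coprime (2 ^ e) x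
coprime-2^-odd (s , refl) e = Coprimality.sym (coprime-^ (Coprimality.sym (coprime-2-odd s)) e)

-- ((q + h)ⁿ - qⁿ) / h
geometric : (q h n : ℕ) → ℕ
geometric q h zero    = 0
geometric q h (suc n) = q ^ n + (q + h) * geometric q h n

[q+h]^n≡ : ∀ q h n → (q + h) ^ n ≡ q ^ n + h * geometric q h n
[q+h]^n≡ q h zero    = cong suc (sym (*-zeroʳ h))
[q+h]^n≡ q h (suc n) = trans (cong ((q + h) *_) ([q+h]^n≡ q h n)) (lemma q h (q ^ n) (geometric q h n))
  where
  lemma : ∀ q h Q G → (q + h) * (Q + h * G) ≡ q * Q + h * (Q + (q + h) * G)
  lemma = solve-∀

-- The quotient is a sum of n products of odd numbers, since q and q + h are odd.
geometric-parity : ∀ q h n → (∃[ s ] q ≡ 1 + 2 * s) → 2 ∣ h → ∃[ v ] geometric q h n ≡ n + 2 * v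
geometric-parity q h zero    _ _ = 0 , refl
geometric-parity q h (suc n) oq@(s , refl) 2∣h@(divides j refl)
  with geometric-parity q h n oq 2∣h | odd-^ oq n
... | v , eq | t , eq′ rewrite eq | eq′ = t + v + (s + j) * (n + 2 * v) , lemma s j t n v
  where
  lemma : ∀ s j t n v → 1 + 2 * t + (1 + 2 * s + j * 2) * (n + 2 * v) ≡
    1 + n + 2 * (t + v + (s + j) * (n + 2 * v))
  lemma = solve-∀

-- By halving n. For odd n the quotient `geometric q h n` is odd, so 2^e already divides h. For n =
-- 2t the difference is one of t-th powers of q² and q² + h′ with h′ = h (2q + h); 4 ∣ h makes 2q +
-- h twice an odd number, so h′ t is an odd multiple of h n.
lifting-the-exponent-2 : ∀ e q h n → (∃[ s ] q ≡ 1 + 2 * s) → 4 ∣ h →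
  2 ^ e ∣ h * geometric q h n → 2 ^ e ∣ h * n
lifting-the-exponent-2 e q h n = go q h n (<-wellFounded n)
  where
  go : ∀ q h n → Acc _<_ n → (∃[ s ] q ≡ 1 + 2 * s) → 4 ∣ h →
       2 ^ e ∣ h * geometric q h n → 2 ^ e ∣ h * n
  go q h zero      _         _  _   div = div
  go q h n@(suc _) (acc rec) oq 4∣h div with even-or-odd n
  ... | inj₂ (t , n≡) = ∣m⇒∣m*n n (Coprimality.coprime-divisor {o = h}
          (coprime-2^-odd G-odd e) (subst (2 ^ e ∣_) (*-comm h _) div))
    where
    G-odd : ∃[ u ] geometric q h n ≡ 1 + 2 * u
    G-odd with geometric-parity q h n oq (∣-trans (divides 2 refl) 4∣h)
    ... | v , eq = t + v , trans eq (trans (cong (_+ 2 * v) n≡) (lemma t v))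
      where
      lemma : ∀ t v → 1 + 2 * t + 2 * v ≡ 1 + 2 * (t + v)
      lemma = solve-∀
  go q h n@(suc _) (acc rec) oq@(s , q≡) 4∣h@(divides j h≡) div | inj₁ (t , n≡) =
    Coprimality.coprime-divisor {n = 1 + 2 * (s + j)} (coprime-2^-odd (s + j , refl) e)
      (subst (2 ^ e ∣_) regroup
        (go (q * q) h′ t (rec t<n) (odd-* oq oq) (∣m⇒∣m*n (2 * q + h) 4∣h) div′))
    where
    h′ = h * (2 * q + h)
    1≤t : ∀ t → n ≡ 2 * t → 1 ≤ t
    1≤t (suc t) _ = s≤s z≤n
    t<n : t < n
    t<n = subst (t <_) (sym n≡) (m<m*n′ t (1≤t t n≡))
      where
      m<m*n′ : ∀ t → 1 ≤ t → t < 2 * t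
      m<m*n′ (suc t) _ = m<m+n (suc t) (s≤s z≤n)
    sq : ∀ b → b ^ n ≡ (b * b) ^ t
    sq b = trans (cong (b ^_) n≡) (trans (^-double b t) (sym (^-distribʳ-* t b b)))
    square : ∀ q h → (q + h) * (q + h) ≡ q * q + h * (2 * q + h)
    square = solve-∀
    same : h * geometric q h n ≡ h′ * geometric (q * q) h′ t
    same = +-cancelˡ-≡ (q ^ n) _ _ (begin
      q ^ n + h * geometric q h n                ≡⟨ [q+h]^n≡ q h n ⟨
      (q + h) ^ n                                ≡⟨ sq (q + h) ⟩
      ((q + h) * (q + h)) ^ t                    ≡⟨ cong (_^ t) (square q h) ⟩
      (q * q + h′) ^ t                           ≡⟨ [q+h]^n≡ (q * q) h′ t ⟩
      (q * q) ^ t + h′ * geometric (q * q) h′ t  ≡⟨ cong (_+ h′ * geometric (q * q) h′ t) (sq q) ⟨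
      q ^ n + h′ * geometric (q * q) h′ t        ∎)
      where open ≡-Reasoning
    div′ : 2 ^ e ∣ h′ * geometric (q * q) h′ t
    div′ = subst (2 ^ e ∣_) same div
    regroup : h′ * t ≡ (1 + 2 * (s + j)) * (h * n)
    regroup rewrite n≡ | h≡ | q≡ = lemma s j t
      where
      lemma : ∀ s j t → j * 4 * (2 * (1 + 2 * s) + j * 4) * t ≡ (1 + 2 * (s + j)) * (j * 4 * (2 * t))
      lemma = solve-∀

-- Congruences

infix 4 _≈_[mod_]
_≈_[mod_] : ℕ → ℕ → ℕ → Set
x ≈ y [mod K ] = ∃[ i ] ∃[ j ] x + i * K ≡ y + j * K

≡⇒≈ : ∀ {x y K} → x ≡ y → x ≈ y [mod K ]
≡⇒≈ refl = 0 , 0 , refl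

≈-sym : ∀ {x y K} → x ≈ y [mod K ] → y ≈ x [mod K ]
≈-sym (i , j , eq) = j , i , sym eq

≈-trans : ∀ {x y z K} → x ≈ y [mod K ] → y ≈ z [mod K ] → x ≈ z [mod K ]
≈-trans {x} {y} {z} {K} (i , j , eq) (k , l , eq′) = i + k , l + j , (begin
  x + (i + k) * K     ≡⟨ assoc x i k K ⟩
  x + i * K + k * K   ≡⟨ cong (_+ k * K) eq ⟩
  y + j * K + k * K   ≡⟨ commute y (j * K) (k * K) ⟩
  y + k * K + j * K   ≡⟨ cong (_+ j * K) eq′ ⟩
  z + l * K + j * K   ≡⟨ assoc z l j K ⟨
  z + (l + j) * K     ∎)
  where
  open ≡-Reasoning
  assoc : ∀ x i k K → x + (i + k) * K ≡ x + i * K + k * K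
  assoc = solve-∀
  commute : ∀ x y z → x + y + z ≡ x + z + y
  commute = solve-∀

≈-* : ∀ {x y u v K} → x ≈ y [mod K ] → u ≈ v [mod K ] → x * u ≈ y * v [mod K ]
≈-* {x} {y} {u} {v} {K} (i , j , eq) (k , l , eq′) =
  x * k + i * u + i * k * K , y * l + j * v + j * l * K ,
  trans (expand x i u k K) (trans (cong₂ _*_ eq eq′) (sym (expand y j v l K)))
  where
  expand : ∀ x i u k K → x * u + (x * k + i * u + i * k * K) * K ≡ (x + i * K) * (u + k * K)
  expand = solve-∀

≈-^ : ∀ {x y K} e → x ≈ y [mod K ] → x ^ e ≈ y ^ e [mod K ]
≈-^ zero    _   = ≡⇒≈ refl
≈-^ (suc e) x≈y = ≈-* x≈y (≈-^ e x≈y)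

≈-+⇒∣ : ∀ {x d K} → x + d ≈ x [mod K ] → K ∣ d
≈-+⇒∣ {x} {d} {K} (i , j , eq) = ∣m+n∣m⇒∣n {m = i * K} (divides j (+-cancelˡ-≡ x _ _
  (trans (lemma x (i * K) d) eq))) (n∣m*n i)
  where
  lemma : ∀ x k d → x + (k + d) ≡ x + d + k
  lemma = solve-∀

[y+x]^-mod-x² : ∀ y x w → (y + x) ^ suc w ≈ y ^ suc w + suc w * y ^ w * x [mod x * x ]
[y+x]^-mod-x² y x zero    = ≡⇒≈ (lemma y x)
  where
  lemma : ∀ y x → (y + x) * 1 ≡ y * 1 + 1 * 1 * x
  lemma = solve-∀
[y+x]^-mod-x² y x (suc w) = ≈-trans
  (≈-* (≡⇒≈ {y + x} refl) ([y+x]^-mod-x² y x w))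
  (0 , suc w * y ^ w , lemma y x w (y ^ w))
  where
  lemma : ∀ y x w Y → (y + x) * (y * Y + (1 + w) * Y * x) + 0 ≡
    y * (y * Y) + (2 + w) * (y * Y) * x + (1 + w) * Y * (x * x)
  lemma = solve-∀

-- Multiply by c^2X, where c = x + y, and use ac = x² - y².
mod-x² : ∀ a x y X Z w j → a + y ≡ x → suc w ≡ 2 * Z + 2 * X →
  (x + y) ^ (2 * Z) ≡ a ^ (2 * X) + j * (x * x) →
  y ^ suc w + suc w * y ^ w * x ≈ y ^ (4 * X) [mod x * x ]
mod-x² a x y X Z w j refl w≡ eq = ≈-trans (≈-sym ([y+x]^-mod-x² y x w))
  (≈-trans (≡⇒≈ c^) (≈-trans (≈-* c²ᶻ≈ (≡⇒≈ {c ^ (2 * X)} refl))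
    (≈-trans (≡⇒≈ ac^) (≈-trans (≈-^ X ac²≈) (≡⇒≈ (^-*-assoc y 4 X))))))
  where
  c = x + y
  c^ : (y + x) ^ suc w ≡ c ^ (2 * Z) * c ^ (2 * X)
  c^ = trans (cong₂ _^_ (+-comm y x) w≡) (^-distribˡ-+-* c (2 * Z) (2 * X))
  c²ᶻ≈ : c ^ (2 * Z) ≈ a ^ (2 * X) [mod x * x ]
  c²ᶻ≈ = 0 , j , trans (+-identityʳ _) eq
  ac^ : a ^ (2 * X) * c ^ (2 * X) ≡ ((a * c) ^ 2) ^ X
  ac^ = trans (sym (^-distribʳ-* (2 * X) a c)) (sym (^-*-assoc (a * c) 2 X))
  ac²≈ : (a * c) ^ 2 ≈ y ^ 4 [mod x * x ]
  -- As ac = x² - y², one has (ac)² + y² x² = y⁴ + ac x².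
  ac²≈ = y * y , a * c , lemma a y
    where
    lemma : ∀ a y → a * (a + y + y) * (a * (a + y + y) * 1) + y * y * ((a + y) * (a + y)) ≡
      y * (y * (y * (y * 1))) + a * (a + y + y) * ((a + y) * (a + y))
    lemma = solve-∀

-- The leading powers cancel, x² divides the linear term, and y is prime to x.
mod-x²-equal : ∀ x y X w .{{_ : NonZero x}} → Coprime x y → y ^ suc w ≡ y ^ (4 * X) →
  y ^ suc w + suc w * y ^ w * x ≈ y ^ (4 * X) [mod x * x ] → x ∣ suc w
mod-x²-equal x y X w cop eq cong-x² rewrite sym eq =
  Coprimality.coprime-divisor (coprime-^ cop w) (subst (x ∣_) (*-comm (suc w) (y ^ w))
    (*-cancelʳ-∣ x (≈-+⇒∣ {y ^ suc w} cong-x²)))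

-- Read modulo x, the linear term vanishes and the factor y^4X, prime to x, cancels. The case f = 0,
-- where the divisibility is empty, is excluded by the application.
mod-x²-greater : ∀ x y X D w → Coprime x y → 1 ≤ y → suc w ≡ 4 * X + 2 * D →
  y ^ suc w + suc w * y ^ w * x ≈ y ^ (4 * X) [mod x * x ] → ∃[ f ] y ^ (2 * D) ≡ 1 + f × x ∣ f
mod-x²-greater x y X D w cop 1≤y w≡ (i , j , eq) with y ^ (2 * D) in yD | 1≤^ 1≤y (2 * D)
... | suc f | _ = f , refl , Coprimality.coprime-divisor (coprime-^ cop (4 * X))
  (∣m+n∣m⇒∣n {m = suc w * y ^ w * x + i * (x * x)}
    (divides (j * x) (+-cancelˡ-≡ Y _ _ (trans (sym shape) (trans eq (cong (Y +_) (sym (*-assoc j x x)))))))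
    (∣m∣n⇒∣m+n (n∣m*n (suc w * y ^ w)) (∣n⇒∣m*n i (n∣m*n x))))
  where
  Y = y ^ (4 * X)
  Yw : y ^ suc w ≡ Y * suc f
  Yw = trans (cong (y ^_) w≡) (trans (^-distribˡ-+-* y (4 * X) (2 * D)) (cong (Y *_) yD))
  shape : y ^ suc w + suc w * y ^ w * x + i * (x * x) ≡
          Y + (suc w * y ^ w * x + i * (x * x) + Y * f)
  shape = trans (cong (λ u → u + suc w * y ^ w * x + i * (x * x)) Yw)
    (lemma Y f (suc w * y ^ w * x) (i * (x * x)))
    where
    lemma : ∀ Y f k l → Y * (1 + f) + k + l ≡ Y + (k + l + Y * f)
    lemma = solve-∀

-- Elementary size estimates

≤-by : ∀ {p q} d → p + d ≡ q → p ≤ q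
≤-by {p} d refl = m≤m+n p d

floor-⅛√ : ∀ M → ∃[ l ] 8 * l * (8 * l) ≤ M × M < 8 * suc l * (8 * suc l)
floor-⅛√ M = bracket (λ l → 8 * l * (8 * l)) (λ l → *-mono-< (lt l) (lt l)) M z≤n
  where
  lt : ∀ l → 8 * l < 8 * suc l
  lt l = *-monoʳ-< 8 (n<1+n l)

-- The induction rests on (l + 2)² ≤ 2 (l + 1)², true from l = 2 on.
2^-dominates-square : ∀ u {e l} → 2 ≤ e → u * (suc e * suc e) ≤ 2 ^ e → e ≤ l →
  u * (suc l * suc l) ≤ 2 ^ l
2^-dominates-square u {e} {l} 2≤e base e≤l with m≤n⇒∃[o]m+o≡n 2≤e | m≤n⇒∃[o]m+o≡n e≤l
... | d , refl | o , refl = go o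
  where
  lemma : ∀ u v → u * ((4 + v) * (4 + v)) + u * (2 + 4 * v + v * v) ≡ 2 * (u * ((3 + v) * (3 + v)))
  lemma = solve-∀
  go : ∀ o → u * (suc (e + o) * suc (e + o)) ≤ 2 ^ (e + o)
  go zero    rewrite +-identityʳ d = base
  go (suc o) rewrite +-suc d o =
    ≤-trans (≤-by (u * (2 + 4 * (d + o) + (d + o) * (d + o))) (lemma u (d + o))) (*-monoʳ-≤ 2 (go o))

2^-dominates-linear : ∀ u {e l} → 1 ≤ e → u * e < 2 ^ (2 * e) → e ≤ l → u * l < 2 ^ (2 * l)
2^-dominates-linear u {e} {l} 1≤e base e≤l with m≤n⇒∃[o]m+o≡n 1≤e | m≤n⇒∃[o]m+o≡n e≤l
... | d , refl | o , refl = go o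
  where
  lemma : ∀ u v → u * (2 + v) + u * (2 + 3 * v) ≡ 4 * (u * (1 + v))
  lemma = solve-∀
  quadruple : ∀ v → 2 + 2 * (1 + v) ≡ 2 * (2 + v)
  quadruple = solve-∀
  go : ∀ o → u * (e + o) < 2 ^ (2 * (e + o))
  go zero    = subst (λ l → u * l < 2 ^ (2 * l)) (sym (+-identityʳ e)) base
  go (suc o) rewrite +-suc d o = begin-strict
    u * (2 + (d + o))                  ≤⟨ ≤-by (u * (2 + 3 * (d + o))) (lemma u (d + o)) ⟩
    4 * (u * (1 + (d + o)))            <⟨ *-monoʳ-< 4 (go o) ⟩
    2 ^ 2 * 2 ^ (2 * (1 + (d + o)))    ≡⟨ ^-distribˡ-+-* 2 2 (2 * (1 + (d + o))) ⟨
    2 ^ (2 + 2 * (1 + (d + o)))        ≡⟨ cong (2 ^_) (quadruple (d + o)) ⟩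
    2 ^ (2 * (2 + (d + o)))            ∎
    where open ≤-Reasoning

-- B² = (C - A)(C + A) with C - A ≥ 1.
C≤B² : ∀ A B C → 1 ≤ B → A * A + B * B ≡ C * C → C ≤ B * B
C≤B² A B C 1≤B eq with A <? C
... | no A≮C = ⊥-elim (<⇒≱ (m<m+n (A * A) (*-mono-≤ 1≤B 1≤B))
        (≤-trans (≤-reflexive eq) (*-mono-≤ (≮⇒≥ A≮C) (≮⇒≥ A≮C))))
... | yes A<C with m≤n⇒∃[o]m+o≡n A<C
... | d , refl = ≤-by (A + d * (2 * A + 1 + d)) (+-cancelˡ-≡ (A * A) _ _ (trans (lemma A d) (sym eq)))
  where
  lemma : ∀ A d → A * A + (1 + A + d + (A + d * (2 * A + 1 + d))) ≡ (1 + A + d) * (1 + A + d)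
  lemma = solve-∀

odd-∣ : ∀ {d x} → d ∣ x → (∃[ s ] x ≡ 1 + 2 * s) → ∃[ t ] d ≡ 1 + 2 * t
odd-∣ {d} d∣x (s , refl) with even-or-odd d
... | inj₂ o = o
... | inj₁ (t , refl) with coprime-2-odd s (∣-refl , ∣-trans (m∣m*n t) d∣x)
... | ()

≡-from-mod : ∀ K q r β γ → q < K → r < K → q + K * β ≡ K * γ + r → q ≡ r
≡-from-mod K@(suc _) q r β γ q<K r<K eq = begin
  q                ≡⟨ m<n⇒m%n≡m q<K ⟨
  q % K            ≡⟨ [m+kn]%n≡m%n q β K ⟨
  (q + β * K) % K  ≡⟨ cong (_% K) (trans (cong (q +_) (*-comm β K)) (trans eq
                        (trans (+-comm (K * γ) r) (cong (r +_) (*-comm K γ))))) ⟩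
  (r + γ * K) % K  ≡⟨ [m+kn]%n≡m%n r γ K ⟩
  r % K            ≡⟨ m<n⇒m%n≡m r<K ⟩
  r                ∎
  where open ≡-Reasoning

-- The factors q + H and q are coprime, hence powers S^2X and T^2X. They are read as X-th powers of
-- S² and T²: the difference h of odd squares is divisible by 4, as lifting the exponent requires,
-- and h ≤ S² ≤ a².
coprime-factors-2-adic : ∀ a q H X e → (∃[ s ] a ≡ 1 + 2 * s) → Coprime (a ^ (2 * X)) H →
  1 ≤ a → 1 ≤ H → 1 ≤ X → 2 ^ e ∣ H → (q + H) * q ≡ a ^ (2 * X) → 2 ^ e ≤ a * a * X
coprime-factors-2-adic a q H X e oa cop 1≤a 1≤H 1≤X 2ᵉ∣H eq = result
  where
  p = q + H
  S = gcd p a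
  T = gcd q a
  coprime-pq : Coprime p q
  coprime-pq (d∣p , d∣q) = cop (subst (_ ∣_) eq (∣m⇒∣m*n q d∣p) , ∣m+n∣m⇒∣n d∣p d∣q)
  square : ∀ b → b ^ (2 * X) ≡ (b * b) ^ X
  square b = trans (^-double b X) (sym (^-distribʳ-* X b b))
  p≡ : p ≡ (S * S) ^ X
  p≡ = trans (coprime-factor-of-power a (2 * X) coprime-pq eq) (square S)
  q≡ : q ≡ (T * T) ^ X
  q≡ = trans (coprime-factor-of-power a (2 * X) (Coprimality.sym coprime-pq)
    (trans (*-comm q p) eq)) (square T)
  T<S : T < S
  T<S with T <? S
  ... | yes lt = lt
  ... | no  ≮  = ⊥-elim (<⇒≱ (m<m+n q 1≤H) (begin
      p           ≡⟨ p≡ ⟩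
      (S * S) ^ X ≤⟨ ^-monoˡ-≤ X (*-mono-≤ (≮⇒≥ ≮) (≮⇒≥ ≮)) ⟩
      (T * T) ^ X ≡⟨ q≡ ⟨
      q           ∎))
    where open ≤-Reasoning
  S≤a : S ≤ a
  S≤a = ∣⇒≤ {{>-nonZero 1≤a}} (gcd[m,n]∣n p a)
  odd-S : ∃[ s ] S ≡ 1 + 2 * s
  odd-S = odd-∣ (gcd[m,n]∣n p a) oa
  odd-T : ∃[ t ] T ≡ 1 + 2 * t
  odd-T = odd-∣ (gcd[m,n]∣n q a) oa
  s = proj₁ odd-S
  t = proj₁ odd-T
  -- This is S² - T² for S = 1 + 2s and T = 1 + 2t.
  h = (s ∸ t) * (1 + s + t) * 4
  t≤s : t ≤ s
  t≤s = *-cancelˡ-≤ 2 (s≤s⁻¹ (subst₂ _≤_ (proj₂ odd-T) (proj₂ odd-S) (<⇒≤ T<S)))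
  S²≡ : S * S ≡ T * T + h
  S²≡ = subst₂ (λ S T → S * S ≡ T * T + h) (sym (proj₂ odd-S)) (sym (proj₂ odd-T)) (diff s t t≤s)
    where
    lemma : ∀ t d → (1 + 2 * (t + d)) * (1 + 2 * (t + d)) ≡
      (1 + 2 * t) * (1 + 2 * t) + d * (1 + (t + d) + t) * 4
    lemma = solve-∀
    diff : ∀ s t → t ≤ s → (1 + 2 * s) * (1 + 2 * s) ≡
      (1 + 2 * t) * (1 + 2 * t) + (s ∸ t) * (1 + s + t) * 4
    diff s t t≤s with m≤n⇒∃[o]m+o≡n t≤s
    ... | d , refl rewrite m+n∸m≡n t d = lemma t d
  H≡ : H ≡ h * geometric (T * T) h X
  H≡ = +-cancelˡ-≡ q _ _ (trans p≡ (trans (cong (_^ X) S²≡)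
    (trans ([q+h]^n≡ (T * T) h X) (cong (_+ h * geometric (T * T) h X) (sym q≡)))))
  1≤h : 1 ≤ h
  1≤h with h | H≡
  ... | zero  | H≡0 = ⊥-elim (<⇒≱ 1≤H (≤-reflexive H≡0))
  ... | suc _ | _   = s≤s z≤n
  result : 2 ^ e ≤ a * a * X
  result = begin
    2 ^ e      ≤⟨ ∣⇒≤ {{>-nonZero (*-mono-≤ 1≤h 1≤X)}} (lifting-the-exponent-2 e (T * T) h X
                    (odd-* odd-T odd-T) (n∣m*n ((s ∸ t) * (1 + s + t))) (subst (2 ^ e ∣_) H≡ 2ᵉ∣H)) ⟩
    h * X      ≤⟨ *-monoˡ-≤ X (m≤n+m h (T * T)) ⟩
    (T * T + h) * X ≡⟨ cong (_* X) S²≡ ⟨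
    S * S * X  ≤⟨ *-monoˡ-≤ X (*-mono-≤ S≤a S≤a) ⟩
    a * a * X  ∎
    where open ≤-Reasoning

-- With λ₀ = ⌊√M / 8⌋ the bound on k becomes k < 4(λ₀ + 1), and the margins needed later become
-- polynomial inequalities in λ₀ ≥ 20.
module Scales (k M : ℕ) (4k²≤M : 4 * (k * k) ≤ M) (2^16≤M : 2 ^ 16 ≤ M) where

  λ₀ : ℕ
  λ₀ = proj₁ (floor-⅛√ M)

  lo : 8 * λ₀ * (8 * λ₀) ≤ M
  lo = proj₁ (proj₂ (floor-⅛√ M))

  hi : M < 8 * suc λ₀ * (8 * suc λ₀)
  hi = proj₂ (proj₂ (floor-⅛√ M))

  20≤λ : 20 ≤ λ₀
  20≤λ with 20 ≤? λ₀
  ... | yes p = p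
  ... | no  ≰ = ⊥-elim (<⇒≱ hi (≤-trans (*-mono-≤ le le) (≤-trans (≤ᵇ⇒≤ (160 * 160) (2 ^ 16) tt) 2^16≤M)))
    where
    le : 8 * suc λ₀ ≤ 160
    le = *-monoʳ-≤ 8 (≰⇒> ≰)

  k≤4λ+3 : k ≤ 4 * λ₀ + 3
  k≤4λ+3 with k ≤? 4 * λ₀ + 3
  ... | yes p = p
  ... | no  ≰ = ⊥-elim (<⇒≱ hi (≤-trans (*-mono-≤ le le) (≤-trans (≤-reflexive (lemma k)) 4k²≤M)))
    where
    lemma : ∀ k → 2 * k * (2 * k) ≡ 4 * (k * k)
    lemma = solve-∀
    lemma′ : ∀ l → 8 * (1 + l) ≡ 2 * (1 + (4 * l + 3))
    lemma′ = solve-∀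
    le : 8 * suc λ₀ ≤ 2 * k
    le = ≤-trans (≤-reflexive (lemma′ λ₀)) (*-monoʳ-≤ 2 (≰⇒> ≰))

  -- Turns Y < 3M into Z < 2Y < 2^λ₀, the form in which the exponents enter the later estimates.
  6M<2^λ : 6 * M < 2 ^ λ₀
  6M<2^λ = <-≤-trans (*-monoʳ-< 6 hi) (≤-trans (≤-reflexive (regroup 6 λ₀))
    (2^-dominates-square (6 * 8 * 8) (≤ᵇ⇒≤ 2 20 tt) (≤ᵇ⇒≤ (6 * 8 * 8 * (21 * 21)) (2 ^ 20) tt) 20≤λ))
    where
    regroup : ∀ u l → u * (8 * (1 + l) * (8 * (1 + l))) ≡ u * 8 * 8 * ((1 + l) * (1 + l))
    regroup = solve-∀

  -- The bit count behind 8 · 2^λ₀ · n² ≤ m.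
  λ+2k+5≤M : λ₀ + 2 * suc k + 3 ≤ M
  λ+2k+5≤M = ≤-trans (+-monoˡ-≤ 3 (+-monoʳ-≤ λ₀ (*-monoʳ-≤ 2 (s≤s k≤4λ+3)))) (≤-trans (go λ₀ 20≤λ) lo)
    where
    open ≤-Reasoning
    regroup : ∀ l → l + 2 * (1 + (4 * l + 3)) + 3 ≡ 9 * l + 11
    regroup = solve-∀
    ten : ∀ l → 9 * l + l ≡ 10 * l
    ten = solve-∀
    go : ∀ l → 20 ≤ l → l + 2 * suc (4 * l + 3) + 3 ≤ 8 * l * (8 * l)
    go l 20≤l = begin
      l + 2 * suc (4 * l + 3) + 3 ≡⟨ regroup l ⟩
      9 * l + 11                  ≤⟨ +-monoʳ-≤ (9 * l) (≤-trans (≤ᵇ⇒≤ 11 20 tt) 20≤l) ⟩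
      9 * l + l                   ≡⟨ ten l ⟩
      10 * l                      ≤⟨ *-monoˡ-≤ l (≤-trans (≤ᵇ⇒≤ 10 20 tt) 20≤l) ⟩
      l * l                       ≤⟨ *-mono-≤ (m≤n*m l 8) (m≤n*m l 8) ⟩
      8 * l * (8 * l)             ∎

  -- The remainder of the expansion is controlled by j + 1 factors Zn² ≤ 2^(λ₀ + 2k + 2); of the two
  -- spare bits one pays for a factor 2, the other makes the inequality strict. In terms of λ₀ the
  -- product is at most 54 λ₀² plus lower terms, against 64 λ₀² ≤ M.
  tail-margin : ∀ j → 2 * j ≤ 3 * (2 + k) → 2 + (λ₀ + 2 * suc k) * suc j ≤ M
  tail-margin j 2j≤ = ≤-trans (+-monoʳ-≤ 2 (*-mono-≤
    (+-monoʳ-≤ λ₀ (*-monoʳ-≤ 2 (s≤s k≤4λ+3))) (s≤s j≤))) (≤-trans (go λ₀ 20≤λ) lo)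
    where
    open ≤-Reasoning
    j≤ : j ≤ 6 * λ₀ + 7
    j≤ = s≤s⁻¹ (*-cancelˡ-< 2 j (suc (6 * λ₀ + 7)) (begin-strict
      2 * j ≤⟨ 2j≤ ⟩
      3 * (2 + k) ≤⟨ *-monoʳ-≤ 3 (+-monoʳ-≤ 2 k≤4λ+3) ⟩
      3 * (2 + (4 * λ₀ + 3)) <⟨ ≤-by 0 (eq λ₀) ⟩
      2 * (suc (6 * λ₀ + 7)) ∎))
      where
      eq : ∀ l → 1 + 3 * (2 + (4 * l + 3)) + 0 ≡ 2 * (1 + (6 * l + 7))
      eq = solve-∀
    expand : ∀ l → 2 + (l + 2 * (1 + (4 * l + 3))) * (1 + (6 * l + 7)) ≡
      54 * (l * l) + 6 * (20 * l) + 66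
    expand = solve-∀
    collect : ∀ l → 54 * (l * l) + 6 * (l * l) + 4 * (l * l) ≡ 8 * l * (8 * l)
    collect = solve-∀
    go : ∀ l → 20 ≤ l → 2 + (l + 2 * suc (4 * l + 3)) * suc (6 * l + 7) ≤ 8 * l * (8 * l)
    go l 20≤l = begin
      2 + (l + 2 * suc (4 * l + 3)) * suc (6 * l + 7) ≡⟨ expand l ⟩
      54 * (l * l) + 6 * (20 * l) + 66
        ≤⟨ +-mono-≤ (+-monoʳ-≤ (54 * (l * l)) (*-monoʳ-≤ 6 (*-monoˡ-≤ l 20≤l)))
             (≤-trans (≤ᵇ⇒≤ 66 (4 * (20 * 20)) tt) (*-monoʳ-≤ 4 (*-mono-≤ 20≤l 20≤l))) ⟩
      54 * (l * l) + 6 * (l * l) + 4 * (l * l)        ≡⟨ collect l ⟩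
      8 * l * (8 * l)                                 ∎

  -- The premise will come from m² < n^4D. With 4D ≤ 3(k + 2) it would give 2M < 3(k + 1)(k + 2) ≤
  -- 4k² + 100 ≤ 2M.
  gap-margin : ∀ D → 2 * M < 2 * suc k * (2 * D) → suc (3 * (2 + k)) ≤ 4 * D
  gap-margin D lt with suc (3 * (2 + k)) ≤? 4 * D
  ... | yes p = p
  ... | no  ≰ = ⊥-elim (<⇒≱ lt (begin
      2 * suc k * (2 * D)         ≡⟨ regroup k D ⟩
      suc k * (4 * D)             ≤⟨ *-monoʳ-≤ (suc k) (s≤s⁻¹ (≰⇒> ≰)) ⟩
      suc k * (3 * (2 + k))       ≤⟨ go k ⟩
      4 * (k * k) + 100           ≤⟨ +-mono-≤ 4k²≤M (≤-trans (≤ᵇ⇒≤ 100 (2 ^ 16) tt) 2^16≤M) ⟩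
      M + M                       ≡⟨ cong (M +_) (+-identityʳ M) ⟨
      2 * M                       ∎))
    where
    open ≤-Reasoning
    regroup : ∀ k D → 2 * (1 + k) * (2 * D) ≡ (1 + k) * (4 * D)
    regroup = solve-∀
    go : ∀ k → suc k * (3 * (2 + k)) ≤ 4 * (k * k) + 100
    go k = begin
      suc k * (3 * (2 + k))         ≡⟨ e₁ k ⟩
      3 * (k * k) + 6 + 9 * k       ≤⟨ +-monoʳ-≤ (3 * (k * k) + 6) (9k≤ k) ⟩
      3 * (k * k) + 6 + (k * k + 81) ≤⟨ ≤-by 13 (e₂ (k * k)) ⟩
      4 * (k * k) + 100             ∎
      where
      e₁ : ∀ k → (1 + k) * (3 * (2 + k)) ≡ 3 * (k * k) + 6 + 9 * k
      e₁ = solve-∀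
      e₂ : ∀ s → 3 * s + 6 + (s + 81) + 13 ≡ 4 * s + 100
      e₂ = solve-∀
      9k≤ : ∀ k → 9 * k ≤ k * k + 81
      9k≤ k with 9 ≤? k
      ... | yes p = ≤-trans (*-monoˡ-≤ k p) (m≤m+n (k * k) 81)
      ... | no  ≰ = ≤-trans (*-monoʳ-≤ 9 (<⇒≤ (≰⇒> ≰))) (m≤n+m 81 (k * k))

-- As a² ≤ 16 · 4^2M, an exponent Y = 3M + r would force 4^(M + r) ≤ 192 (M + r), where 192 = 2⁴ · 4
-- · 3.
4^Y≤a²4Y⇒Y<3M : ∀ a M Y → 6 ≤ M → a ≤ 2 ^ suc M * 2 ^ suc M → 2 ^ (2 * Y) ≤ a * a * (4 * Y) → Y < 3 * M
4^Y≤a²4Y⇒Y<3M a M Y 6≤M a≤ 4^Y≤ with Y <? 3 * M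
... | yes p = p
... | no  ≮ with m≤n⇒∃[o]m+o≡n (≮⇒≥ ≮)
... | r , refl = ⊥-elim (go (2 ^ M) 2 4 refl T⁴ (2^-dominates-linear (2 * 2 * 2 * 2 * 4 * 3) {6} {M + r}
    (≤ᵇ⇒≤ 1 6 tt) (≤ᵇ⇒≤ (suc (2 * 2 * 2 * 2 * 4 * 3 * 6)) (2 ^ 12) tt) (≤-trans 6≤M (m≤m+n M r))) 4^Y≤ a≤)
  where
  T⁴ : 2 ^ M * 2 ^ M * (2 ^ M * 2 ^ M) ≡ 2 ^ (4 * M)
  T⁴ = trans (cong₂ _*_ (sym (^-double 2 M)) (sym (^-double 2 M)))
    (trans (sym (^-double 2 (2 * M))) (cong (2 ^_) (sym (*-assoc 2 2 M))))
  exponent : ∀ M r → 4 * M + 2 * (M + r) ≡ 2 * (3 * M + r)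
  exponent = solve-∀
  collect : ∀ T M r s u → s * T * (s * T) * (s * T * (s * T)) * (u * (3 * M + 3 * r)) ≡
    T * T * (T * T) * (s * s * s * s * u * 3 * (M + r))
  collect = solve-∀
  open ≤-Reasoning
  go : ∀ T s u → s * T ≡ 2 ^ suc M → T * T * (T * T) ≡ 2 ^ (4 * M) →
    s * s * s * s * u * 3 * (M + r) < 2 ^ (2 * (M + r)) →
    2 ^ (2 * (3 * M + r)) ≤ a * a * (u * (3 * M + r)) → a ≤ 2 ^ suc M * 2 ^ suc M → ⊥
  go T s u sT T⁴ lt le a≤ = <⇒≱ lt (*-cancelˡ-≤ (2 ^ (4 * M)) {{m^n≢0 2 (4 * M)}} (begin
    2 ^ (4 * M) * 2 ^ (2 * (M + r))   ≡⟨ ^-distribˡ-+-* 2 (4 * M) (2 * (M + r)) ⟨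
    2 ^ (4 * M + 2 * (M + r))         ≡⟨ cong (2 ^_) (exponent M r) ⟩
    2 ^ (2 * (3 * M + r))             ≤⟨ le ⟩
    a * a * (u * (3 * M + r))
      ≤⟨ *-mono-≤ (*-mono-≤ a≤′ a≤′) (*-monoʳ-≤ u (+-monoʳ-≤ (3 * M) (m≤n*m r 3))) ⟩
    s * T * (s * T) * (s * T * (s * T)) * (u * (3 * M + 3 * r)) ≡⟨ collect T M r s u ⟩
    T * T * (T * T) * (s * s * s * s * u * 3 * (M + r))
      ≡⟨ cong (_* (s * s * s * s * u * 3 * (M + r))) T⁴ ⟩
    2 ^ (4 * M) * (s * s * s * s * u * 3 * (M + r))             ∎))
    where
    a≤′ : a ≤ s * T * (s * T)
    a≤′ = subst (λ t → a ≤ t * t) (sym sT) a≤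

2mn<m²+n² : ∀ {m n} → n < m → 2 * m * n < m * m + n * n
2mn<m²+n² {n = n} n<m with m≤n⇒∃[o]m+o≡n n<m
... | d , refl = ≤-by (d * d + 2 * d) (lemma n d)
  where
  lemma : ∀ n d → 1 + 2 * (1 + n + d) * n + (d * d + 2 * d) ≡ (1 + n + d) * (1 + n + d) + n * n
  lemma = solve-∀

square-cancel-< : ∀ {s t} → s * s < t * t → s < t
square-cancel-< lt = ≰⇒> λ t≤s → <⇒≱ lt (*-mono-≤ t≤s t≤s)

^-monoʳ-∣ : ∀ b {e f} → e ≤ f → b ^ e ∣ b ^ f
^-monoʳ-∣ b {e} e≤f with m≤n⇒∃[o]m+o≡n e≤f
... | o , refl = subst (b ^ e ∣_) (sym (^-distribˡ-+-* b e o)) (m∣m*n (b ^ o))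

half-up : ∀ x → ∃[ i ] x ≤ 2 * i × 2 * i ≤ suc x
half-up x with even-or-odd x
... | inj₁ (i , refl) = i , ≤-refl , n≤1+n _
... | inj₂ (i , refl) = suc i , ≤-trans (n≤1+n _) (≤-reflexive (lemma i)) , ≤-reflexive (sym (lemma i))
  where
  lemma : ∀ i → 2 + 2 * i ≡ 2 * (1 + i)
  lemma = solve-∀

binomial-tail-+ : ∀ x y i j {Z} → i + j ≡ Z →
  ∃[ Q ] ∃[ R ] (x + y) ^ Z ≡ x ^ i * Q + y ^ suc j * R × x * R ≤ Z ^ suc j * (x + y) ^ i
binomial-tail-+ x y i j refl with binomial-tail x y i (suc j)
... | tail rewrite +-suc i j = tail

-- A² is at most C² / 4, which leaves B² ≥ 3C² / 4.
C≤2B : ∀ A B C → 2 * A ≤ C → A * A + B * B ≡ C * C → C ≤ 2 * B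
C≤2B A B C 2A≤C eq = ≮⇒≥ λ 2B<C → <⇒≱ (+-mono-≤-< (*-mono-≤ 2A≤C 2A≤C) (*-mono-< 2B<C 2B<C))
  (≤-trans (≤-by (2 * (C * C)) (double (C * C))) (≤-reflexive (trans (cong (4 *_) (sym eq)) (lemma A B))))
  where
  double : ∀ s → s + s + 2 * s ≡ 4 * s
  double = solve-∀
  lemma : ∀ A B → 4 * (A * A + B * B) ≡ 2 * A * (2 * A) + 2 * B * (2 * B)
  lemma = solve-∀

-- Solutions with even exponents when log m dominates (log n)²

module _ (a m n k M : ℕ)
  (a+n²≡m² : a + n * n ≡ m * m) (coprime-mn : Coprime m n)
  (odd-a : ∃[ s ] a ≡ 1 + 2 * s) (2∣mn : 2 ∣ m * n)
  (1≤n : 1 ≤ n) (n<2^k+1 : n < 2 ^ suc k)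
  (2^M≤m : 2 ^ M ≤ m) (m<2^M+1 : m < 2 ^ suc M)
  (4k²≤M : 4 * (k * k) ≤ M) (2^16≤M : 2 ^ 16 ≤ M)
  where

  open Scales k M 4k²≤M 2^16≤M
  open ≤-Reasoning

  private
    b c : ℕ
    b = 2 * m * n
    c = m * m + n * n

    1≤m : 1 ≤ m
    1≤m = ≤-trans (1≤^ 1≤2 M) 2^M≤m

    n²≤2^2[k+1] : n * n ≤ 2 ^ (2 * suc k)
    n²≤2^2[k+1] = ≤-trans (*-mono-≤ (<⇒≤ n<2^k+1) (<⇒≤ n<2^k+1)) (≤-reflexive (sym (^-double 2 (suc k))))

    2^λn²8≤m : 2 ^ λ₀ * (n * n) * 8 ≤ m
    2^λn²8≤m = begin
      2 ^ λ₀ * (n * n) * 8                ≤⟨ *-monoˡ-≤ 8 (*-monoʳ-≤ (2 ^ λ₀) n²≤2^2[k+1]) ⟩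
      2 ^ λ₀ * 2 ^ (2 * suc k) * 8        ≡⟨ cong (_* 8) (^-distribˡ-+-* 2 λ₀ (2 * suc k)) ⟨
      2 ^ (λ₀ + 2 * suc k) * 2 ^ 3        ≡⟨ ^-distribˡ-+-* 2 (λ₀ + 2 * suc k) 3 ⟨
      2 ^ (λ₀ + 2 * suc k + 3)            ≤⟨ ^-monoʳ 1≤2 λ+2k+5≤M ⟩
      2 ^ M                               ≤⟨ 2^M≤m ⟩
      m                                   ∎

    m≤m² : m ≤ m * m
    m≤m² = m≤m*n m m {{>-nonZero 1≤m}}

    z*8n²≤m : ∀ {z} → z ≤ 2 ^ λ₀ → z * (n * n) * 8 ≤ m
    z*8n²≤m le = ≤-trans (*-monoˡ-≤ 8 (*-monoˡ-≤ (n * n) le)) 2^λn²8≤m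

    -- The condition of `[p+q]^z≤2p^z` for c = a + 2n²: the z-th powers of c and a differ by a
    -- factor of at most 2.
    4zn²≤a : ∀ {z} → 1 ≤ z → z ≤ 2 ^ λ₀ → 2 * z * (2 * (n * n)) ≤ a
    4zn²≤a {z} 1≤z z≤ = +-cancelʳ-≤ (n * n) _ a (begin
      2 * z * (2 * (n * n)) + n * n       ≤⟨ +-monoʳ-≤ _ (m≤n*m (n * n) z {{>-nonZero 1≤z}}) ⟩
      2 * z * (2 * (n * n)) + z * (n * n) ≤⟨ ≤-by (3 * (z * (n * n))) (lemma z (n * n)) ⟩
      z * (n * n) * 8                     ≤⟨ z*8n²≤m z≤ ⟩
      m                                   ≤⟨ m≤m² ⟩
      m * m                               ≡⟨ a+n²≡m² ⟨
      a + n * n                           ∎)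
      where
      lemma : ∀ z y → 2 * z * (2 * y) + z * y + 3 * (z * y) ≡ z * y * 8
      lemma = solve-∀

    4n²≤a : 2 * 1 * (2 * (n * n)) ≤ a
    4n²≤a = 4zn²≤a ≤-refl (1≤^ 1≤2 λ₀)

    4≤a : 4 ≤ a
    4≤a = ≤-trans (*-monoʳ-≤ 2 (*-monoʳ-≤ 2 (*-mono-≤ 1≤n 1≤n))) 4n²≤a

    1≤a : 1 ≤ a
    1≤a = ≤-trans (≤ᵇ⇒≤ 1 4 tt) 4≤a

    c≡a+2n² : c ≡ a + 2 * (n * n)
    c≡a+2n² = trans (cong (_+ n * n) (sym a+n²≡m²)) (lemma a (n * n))
      where
      lemma : ∀ a y → a + y + y ≡ a + 2 * y
      lemma = solve-∀

    a≤c : a ≤ c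
    a≤c = subst (a ≤_) (sym c≡a+2n²) (m≤m+n a _)

    1≤c : 1 ≤ c
    1≤c = ≤-trans 1≤a a≤c

    m²≤c : m * m ≤ c
    m²≤c = m≤m+n (m * m) (n * n)

    c≤a² : c ≤ a * a
    c≤a² = begin
      c                    ≡⟨ c≡a+2n² ⟩
      a + 2 * (n * n)      ≤⟨ +-monoʳ-≤ a (≤-by (2 * (n * n)) (lemma (n * n))) ⟩
      a + 2 * 1 * (2 * (n * n)) ≤⟨ +-monoʳ-≤ a 4n²≤a ⟩
      a + a                ≡⟨ cong (a +_) (+-identityʳ a) ⟨
      2 * a                ≤⟨ *-monoˡ-≤ a (≤-trans (≤ᵇ⇒≤ 2 4 tt) 4≤a) ⟩
      a * a                ∎
      where
      lemma : ∀ y → 2 * y + 2 * y ≡ 2 * 1 * (2 * y)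
      lemma = solve-∀

    n<m : n < m
    n<m = begin-strict
      n                    ≤⟨ m≤m*n n n {{>-nonZero 1≤n}} ⟩
      n * n                <⟨ m<m+n (n * n) (*-mono-≤ 1≤n 1≤n) ⟩
      n * n + n * n        ≤⟨ ≤-by (6 * (n * n)) (lemma (n * n)) ⟩
      1 * (n * n) * 8      ≤⟨ z*8n²≤m (1≤^ 1≤2 λ₀) ⟩
      m                    ∎
      where
      lemma : ∀ y → y + y + 6 * y ≡ 1 * y * 8
      lemma = solve-∀

    b<c : b < c
    b<c = 2mn<m²+n² n<m

    1≤b : 1 ≤ b
    1≤b = *-mono-≤ (*-mono-≤ 1≤2 1≤m) 1≤n

    c<b² : c < b * b
    c<b² = begin-strict
      c                    ≡⟨⟩
      m * m + n * n        <⟨ +-monoʳ-< (m * m) (*-mono-< n<m n<m) ⟩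
      m * m + m * m        ≤⟨ ≤-by (2 * (m * m)) (lemma m) ⟩
      2 * m * 1 * (2 * m * 1) ≤⟨ *-mono-≤ (*-monoʳ-≤ (2 * m) 1≤n) (*-monoʳ-≤ (2 * m) 1≤n) ⟩
      b * b                ∎
      where
      lemma : ∀ m → m * m + m * m + 2 * (m * m) ≡ 2 * m * 1 * (2 * m * 1)
      lemma = solve-∀

    coprime-a-m : Coprime a m
    coprime-a-m {d} (d∣a , d∣m) = coprime-* coprime-mn coprime-mn
      (d∣m , ∣m+n∣m⇒∣n (subst (d ∣_) (sym a+n²≡m²) (∣m⇒∣m*n m d∣m)) d∣a)

    coprime-a-n : Coprime a n
    coprime-a-n {d} (d∣a , d∣n) = coprime-* (Coprimality.sym coprime-mn) (Coprimality.sym coprime-mn)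
      (d∣n , subst (d ∣_) a+n²≡m² (∣m∣n⇒∣m+n d∣a (∣m⇒∣m*n n d∣n)))

    coprime-a-2 : Coprime a 2
    coprime-a-2 = Coprimality.sym (subst (Coprime 2) (sym (proj₂ odd-a)) (coprime-2-odd (proj₁ odd-a)))

    coprime-a^ : ∀ {t} e → Coprime a t → Coprime (a ^ e) t
    coprime-a^ e cop = Coprimality.sym (coprime-^ (Coprimality.sym cop) e)

    4∣b : 4 ∣ b
    4∣b = subst (4 ∣_) (sym (*-assoc 2 m n)) (*-monoʳ-∣ 2 2∣mn)

  -- Comparison of the exponents and the bound on Y

  module Solution (X Y Z : ℕ) (1≤X : 1 ≤ X) (1≤Y : 1 ≤ Y) (1≤Z : 1 ≤ Z)
    (equation : a ^ (2 * X) + b ^ (2 * Y) ≡ c ^ (2 * Z)) where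

    private
      A B C : ℕ
      A = a ^ X
      B = b ^ Y
      C = c ^ Z

      A²+B²≡C² : A * A + B * B ≡ C * C
      A²+B²≡C² = subst₂ _≡_ (cong₂ _+_ (^-double a X) (^-double b Y)) (^-double c Z) equation

      1≤B : 1 ≤ B
      1≤B = 1≤^ 1≤b Y

      A<C : A < C
      A<C = square-cancel-< (subst (A * A <_) A²+B²≡C² (m<m+n (A * A) (*-mono-≤ 1≤B 1≤B)))

      B<C : B < C
      B<C = square-cancel-< (subst (B * B <_) A²+B²≡C² (m<n+m (B * B) (*-mono-≤ 1≤A 1≤A)))
        where
        1≤A : 1 ≤ A
        1≤A = 1≤^ 1≤a X

      C<c^2Y : C < c ^ (2 * Y)
      C<c^2Y = ≤-<-trans (C≤B² A B C 1≤B A²+B²≡C²)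
        (subst (_< c ^ (2 * Y)) (^-double b Y) (^-monoˡ-< (2 * Y) {{>-nonZero 1≤2Y}} b<c))
        where
        1≤2Y : 1 ≤ 2 * Y
        1≤2Y = *-mono-≤ 1≤2 1≤Y

      Z<2Y : Z < 2 * Y
      Z<2Y = ^-cancelʳ-< Z (2 * Y) 1≤c C<c^2Y

      X<4Y : X < 4 * Y
      X<4Y = ^-cancelʳ-< X (4 * Y) 1≤a (begin-strict
        a ^ X                  <⟨ A<C ⟩
        C                      <⟨ C<c^2Y ⟩
        c ^ (2 * Y)            ≤⟨ ^-monoˡ-≤ (2 * Y) c≤a² ⟩
        (a * a) ^ (2 * Y)      ≡⟨ ^-distribʳ-* (2 * Y) a a ⟩
        a ^ (2 * Y) * a ^ (2 * Y) ≡⟨ ^-double a (2 * Y) ⟨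
        a ^ (2 * (2 * Y))      ≡⟨ cong (a ^_) (*-assoc 2 2 Y) ⟨
        a ^ (4 * Y)            ∎)

      q : ℕ
      q = C ∸ B

      q+B≡C : q + B ≡ C
      q+B≡C = m∸n+n≡m (<⇒≤ B<C)

      factored : (q + 2 * B) * q ≡ a ^ (2 * X)
      factored = +-cancelʳ-≡ (B * B) _ _ (begin-equality
        (q + 2 * B) * q + B * B      ≡⟨ lemma q B ⟩
        (q + B) * (q + B)            ≡⟨ cong (λ u → u * u) q+B≡C ⟩
        C * C                        ≡⟨ A²+B²≡C² ⟨
        A * A + B * B                ≡⟨ cong (_+ B * B) (^-double a X) ⟨
        a ^ (2 * X) + B * B          ∎)
        where
        lemma : ∀ q B → (q + 2 * B) * q + B * B ≡ (q + B) * (q + B)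
        lemma = solve-∀

      -- 4 ∣ b because mn is even, so 4^Y divides 2B, the difference of the two factors. The X left
      -- over by lifting the exponent is traded for 4Y, leaving an inequality in a and Y.
      4^Y≤a²4Y : 2 ^ (2 * Y) ≤ a * a * (4 * Y)
      4^Y≤a²4Y = ≤-trans (coprime-factors-2-adic a q (2 * B) X (2 * Y) odd-a
          (coprime-a^ (2 * X) (coprime-* coprime-a-2 (coprime-^ coprime-a-b Y)))
          1≤a (*-mono-≤ 1≤2 1≤B) 1≤X
          (∣n⇒∣m*n 2 (subst (_∣ B) (^-*-assoc 2 2 Y) (^-mono-∣ Y 4∣b))) factored)
        (*-monoʳ-≤ (a * a) (<⇒≤ X<4Y))
        where
        coprime-a-b : Coprime a b
        coprime-a-b = coprime-* (coprime-* coprime-a-2 coprime-a-m) coprime-a-n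

      Y<3M : Y < 3 * M
      Y<3M = 4^Y≤a²4Y⇒Y<3M a M Y (≤-trans (≤ᵇ⇒≤ 6 (2 ^ 16) tt) 2^16≤M)
        (≤-trans (m≤m+n a (n * n)) (≤-trans (≤-reflexive a+n²≡m²) (*-mono-≤ (<⇒≤ m<2^M+1) (<⇒≤ m<2^M+1))))
        4^Y≤a²4Y

      2Y<2^λ : 2 * Y < 2 ^ λ₀
      2Y<2^λ = <-trans (*-monoʳ-< 2 Y<3M) (subst (_< 2 ^ λ₀) (*-assoc 2 3 M) 6M<2^λ)

      Z<2^λ : Z < 2 ^ λ₀
      Z<2^λ = <-trans Z<2Y 2Y<2^λ

      c^Z≤2a^Z : C ≤ 2 * a ^ Z
      c^Z≤2a^Z = subst (λ u → u ^ Z ≤ 2 * a ^ Z) (sym c≡a+2n²)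
        ([p+q]^z≤2p^z a (2 * (n * n)) Z 1≤a (4zn²≤a {Z} 1≤Z (<⇒≤ Z<2^λ)))

      A<a^1+Z : A < a * a ^ Z
      A<a^1+Z = <-≤-trans A<C (≤-trans c^Z≤2a^Z (*-monoˡ-≤ (a ^ Z) (≤-trans (≤ᵇ⇒≤ 2 4 tt) 4≤a)))

      X≤Z : X ≤ Z
      X≤Z = ≮⇒≥ λ Z<X → <⇒≱ A<a^1+Z (^-monoʳ 1≤a Z<X)

    -- Contradiction when Y ≥ 2

    module _ (2≤Y : 2 ≤ Y) where

      x y W w : ℕ
      x = m * m
      y = n * n
      W = 2 * Z + 2 * X
      w = pred W

      1≤x : 1 ≤ x
      1≤x = *-mono-≤ 1≤m 1≤m

      1≤y : 1 ≤ y
      1≤y = *-mono-≤ 1≤n 1≤n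

      coprime-xy : Coprime x y
      coprime-xy = coprime-* (Coprimality.sym (coprime-* cop cop)) (Coprimality.sym (coprime-* cop cop))
        where
        cop : Coprime n m
        cop = Coprimality.sym coprime-mn

      1+w≡W : suc w ≡ W
      1+w≡W = suc-pred W {{>-nonZero (≤-trans (*-mono-≤ 1≤2 1≤Z) (m≤m+n (2 * Z) (2 * X)))}}

      -- Here Y ≥ 2 enters: b is a multiple of m and occurs at least four times.
      x²∣b^2Y : x * x ∣ b ^ (2 * Y)
      x²∣b^2Y = subst (_∣ b ^ (2 * Y)) (lemma m)
        (∣-trans (^-mono-∣ {m} {b} 4 (∣m⇒∣m*n n (n∣m*n 2))) (^-monoʳ-∣ b {4} {2 * Y} (*-monoʳ-≤ 2 2≤Y)))
        where
        lemma : ∀ m → m * (m * (m * (m * 1))) ≡ m * m * (m * m)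
        lemma = solve-∀

      congruence : y ^ suc w + suc w * y ^ w * x ≈ y ^ (4 * X) [mod x * x ]
      congruence = mod-x² a x y X Z w (quotient x²∣b^2Y) a+n²≡m² 1+w≡W
        (trans (sym equation) (cong (a ^ (2 * X) +_) (m∣n⇒n≡quotient*m x²∣b^2Y)))

      W<x : suc w < x
      W<x = begin-strict
        suc w                  ≡⟨ 1+w≡W ⟩
        2 * Z + 2 * X          ≤⟨ +-monoʳ-≤ (2 * Z) (*-monoʳ-≤ 2 X≤Z) ⟩
        2 * Z + 2 * Z          <⟨ +-mono-< (*-monoʳ-< 2 Z<2^λ) (*-monoʳ-< 2 Z<2^λ) ⟩
        2 * 2 ^ λ₀ + 2 * 2 ^ λ₀ ≤⟨ ≤-by (4 * 2 ^ λ₀) (lemma (2 ^ λ₀)) ⟩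
        2 ^ λ₀ * 1 * 8         ≤⟨ *-monoˡ-≤ 8 (*-monoʳ-≤ (2 ^ λ₀) 1≤y) ⟩
        2 ^ λ₀ * y * 8         ≤⟨ 2^λn²8≤m ⟩
        m                      ≤⟨ m≤m² ⟩
        x                      ∎
        where
        lemma : ∀ L → 2 * L + 2 * L + 4 * L ≡ L * 1 * 8
        lemma = solve-∀

      -- Comparing powers instead of exponents excludes X = Z and n = 1 together.
      y^W≢ : y ^ suc w ≢ y ^ (4 * X)
      y^W≢ eq = <⇒≱ W<x (∣⇒≤ (mod-x²-equal x y X w {{>-nonZero 1≤x}} coprime-xy eq congruence))

      D : ℕ
      D = Z ∸ X

      X+D≡Z : X + D ≡ Z
      X+D≡Z = m+[n∸m]≡n X≤Z

      1+w≡4X+2D : suc w ≡ 4 * X + 2 * D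
      1+w≡4X+2D = trans 1+w≡W (trans (cong (λ z → 2 * z + 2 * X) (sym X+D≡Z)) (lemma X D))
        where
        lemma : ∀ X D → 2 * (X + D) + 2 * X ≡ 4 * X + 2 * D
        lemma = solve-∀

      x<y^2D : x < y ^ (2 * D)
      x<y^2D = bound (mod-x²-greater x y X D w coprime-xy 1≤y 1+w≡4X+2D congruence)
        where
        bound : ∃[ f ] y ^ (2 * D) ≡ 1 + f × x ∣ f → x < y ^ (2 * D)
        bound (zero  , eq , _)   = ⊥-elim (y^W≢ (trans (cong (y ^_) 1+w≡4X+2D)
          (trans (^-distribˡ-+-* y (4 * X) (2 * D)) (trans (cong (y ^ (4 * X) *_) eq) (*-identityʳ _)))))
        bound (suc f , eq , x∣f) = subst (x <_) (sym eq) (s≤s (∣⇒≤ x∣f))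

      2≤n : 2 ≤ n
      2≤n = ≰⇒> λ n≤1 → <⇒≱ x<y^2D (begin
        y ^ (2 * D)     ≤⟨ ^-monoˡ-≤ (2 * D) (*-mono-≤ n≤1 n≤1) ⟩
        1 ^ (2 * D)     ≡⟨ ^-zeroˡ (2 * D) ⟩
        1               ≤⟨ 1≤x ⟩
        x               ∎)

      -- Chosen so that m^N covers (2n)^Y: 2n ≤ 2^(k + 2), Y < 3M and 2^M ≤ m.
      N : ℕ
      N = 3 * (2 + k)

      N<4D : suc N ≤ 4 * D
      N<4D = gap-margin D (^-cancelʳ-< (2 * M) (2 * suc k * (2 * D)) 1≤2 (begin-strict
        2 ^ (2 * M)                   ≡⟨ ^-double 2 M ⟩
        2 ^ M * 2 ^ M                 ≤⟨ *-mono-≤ 2^M≤m 2^M≤m ⟩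
        x                             <⟨ x<y^2D ⟩
        y ^ (2 * D)                   ≤⟨ ^-monoˡ-≤ (2 * D) n²≤2^2[k+1] ⟩
        (2 ^ (2 * suc k)) ^ (2 * D)   ≡⟨ ^-*-assoc 2 (2 * suc k) (2 * D) ⟩
        2 ^ (2 * suc k * (2 * D))     ∎))

      1≤D : 1 ≤ D
      1≤D = n≢0⇒n>0 λ D≡0 → <⇒≱ (subst (λ D → suc N ≤ 4 * D) D≡0 N<4D) z≤n

      2A≤C : 2 * A ≤ C
      2A≤C = begin
        2 * a ^ X       ≤⟨ *-mono-≤ (≤-trans (≤ᵇ⇒≤ 2 4 tt) (≤-trans 4≤a a≤c)) (^-monoˡ-≤ X a≤c) ⟩
        c ^ suc X       ≤⟨ ^-monoʳ 1≤c (subst₂ _≤_ (+-comm X 1) X+D≡Z (+-monoʳ-≤ X 1≤D)) ⟩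
        c ^ Z           ∎

      C≤2b^Y : C ≤ 2 * B
      C≤2b^Y = C≤2B A B C 2A≤C A²+B²≡C²

      Y<2Z : Y < 2 * Z
      Y<2Z = ≰⇒> λ 2Z≤Y → <⇒≱ B<C (begin
        c ^ Z           ≤⟨ ^-monoˡ-≤ Z (<⇒≤ c<b²) ⟩
        (b * b) ^ Z     ≡⟨ trans (^-distribʳ-* Z b b) (sym (^-double b Z)) ⟩
        b ^ (2 * Z)     ≤⟨ ^-monoʳ 1≤b 2Z≤Y ⟩
        b ^ Y           ∎)

      B≡ : B ≡ m ^ Y * (2 * n) ^ Y
      B≡ = trans (cong (_^ Y) (lemma m n)) (^-distribʳ-* Y m (2 * n))
        where
        lemma : ∀ m n → 2 * m * n ≡ m * (2 * n)
        lemma = solve-∀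

      [2n]^Y≤m^N : (2 * n) ^ Y ≤ m ^ N
      [2n]^Y≤m^N = begin
        (2 * n) ^ Y                 ≤⟨ ^-monoˡ-≤ Y (*-monoʳ-≤ 2 (<⇒≤ n<2^k+1)) ⟩
        (2 ^ (2 + k)) ^ Y           ≡⟨ ^-*-assoc 2 (2 + k) Y ⟩
        2 ^ ((2 + k) * Y)           ≤⟨ ^-monoʳ 1≤2 (*-monoʳ-≤ (2 + k) (<⇒≤ Y<3M)) ⟩
        2 ^ ((2 + k) * (3 * M))     ≡⟨ cong (2 ^_) (lemma k M) ⟩
        2 ^ (M * N)                 ≡⟨ ^-*-assoc 2 M N ⟨
        (2 ^ M) ^ N                 ≤⟨ ^-monoˡ-≤ N 2^M≤m ⟩
        m ^ N                       ∎
        where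
        lemma : ∀ k M → (2 + k) * (3 * M) ≡ M * (3 * (2 + k))
        lemma = solve-∀

      8≤m : 1 * (1 * 1) * 8 ≤ m
      8≤m = ≤-trans (*-monoˡ-≤ 8 (*-monoʳ-≤ 1 1≤y)) (z*8n²≤m {1} (1≤^ 1≤2 λ₀))

      2<m : 2 < m
      2<m = ≤-trans (≤ᵇ⇒≤ 3 8 tt) 8≤m

      instance
        m≢0 : NonZero m
        m≢0 = >-nonZero 1≤m

      C≤2m^Y*m^N : C ≤ 2 * (m ^ Y * m ^ N)
      C≤2m^Y*m^N = ≤-trans C≤2b^Y (*-monoʳ-≤ 2
        (≤-trans (≤-reflexive B≡) (*-monoʳ-≤ (m ^ Y) [2n]^Y≤m^N)))

      m^2[_] : ∀ e → (m * m) ^ e ≡ m ^ (2 * e)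
      m^2[ e ] = trans (^-distribʳ-* e m m) (sym (^-double m e))

      -- From (q + 2B) q = a^2X ≤ c^2X and q + 2B ≥ c^Z follows q c^2D ≤ c^Z. Here c^2D ≥ m^4D ≥
      -- m^(N + 1), while c^Z ≤ 2 m^(Y + N): the gap D costs more than (2n)^Y contributes.
      q<m^Y : q < m ^ Y
      q<m^Y = ≰⇒> λ m^Y≤q → <⇒≱ 2<m (*-cancelʳ-≤ m 2 (m ^ Y * m ^ N)
        {{m*n≢0 (m ^ Y) (m ^ N) {{m^n≢0 m Y}} {{m^n≢0 m N}}}} (begin
          m * (m ^ Y * m ^ N)       ≡⟨ shuffle m (m ^ Y) (m ^ N) ⟩
          m ^ suc N * m ^ Y         ≤⟨ *-mono-≤ m^1+N≤ m^Y≤q ⟩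
          c ^ (2 * D) * q           ≤⟨ c^2D*q≤C ⟩
          C                         ≤⟨ C≤2m^Y*m^N ⟩
          2 * (m ^ Y * m ^ N)       ∎))
        where
        shuffle : ∀ m u v → m * (u * v) ≡ m * v * u
        shuffle = solve-∀
        swap : ∀ u v q → u * (v * q) ≡ v * (u * q)
        swap = solve-∀
        1≤C : 1 ≤ C
        1≤C = 1≤^ 1≤c Z
        m^1+N≤ : m ^ suc N ≤ c ^ (2 * D)
        m^1+N≤ = begin
          m ^ suc N             ≤⟨ ^-monoʳ 1≤m N<4D ⟩
          m ^ (4 * D)           ≡⟨ cong (m ^_) (*-assoc 2 2 D) ⟩
          m ^ (2 * (2 * D))     ≡⟨ m^2[ 2 * D ] ⟨
          (m * m) ^ (2 * D)     ≤⟨ ^-monoˡ-≤ (2 * D) m²≤c ⟩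
          c ^ (2 * D)           ∎
        c^2D*q≤C : c ^ (2 * D) * q ≤ C
        c^2D*q≤C = *-cancelˡ-≤ C {{>-nonZero 1≤C}} (begin
          C * (c ^ (2 * D) * q)           ≡⟨ swap C (c ^ (2 * D)) q ⟩
          c ^ (2 * D) * (C * q)           ≤⟨ *-monoʳ-≤ (c ^ (2 * D)) (*-monoˡ-≤ q C≤q+2B) ⟩
          c ^ (2 * D) * ((q + 2 * B) * q) ≡⟨ cong (c ^ (2 * D) *_) factored ⟩
          c ^ (2 * D) * a ^ (2 * X)       ≤⟨ *-monoʳ-≤ (c ^ (2 * D)) (^-monoˡ-≤ (2 * X) a≤c) ⟩
          c ^ (2 * D) * c ^ (2 * X)       ≡⟨ ^-distribˡ-+-* c (2 * D) (2 * X) ⟨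
          c ^ (2 * D + 2 * X)             ≡⟨ cong (c ^_) (trans (lemma D X) (cong (2 *_) X+D≡Z)) ⟩
          c ^ (2 * Z)                     ≡⟨ ^-double c Z ⟩
          C * C                           ∎)
          where
          lemma : ∀ D X → 2 * D + 2 * X ≡ 2 * (X + D)
          lemma = solve-∀
          C≤q+2B : C ≤ q + 2 * B
          C≤q+2B = subst (_≤ q + 2 * B) q+B≡C (+-monoʳ-≤ q (m≤m+n B _))

      -- i is Y / 2 rounded up, so that x^i = m^2i is divisible by m^Y and exceeds it by at most one
      -- factor m.
      i j : ℕ
      i = proj₁ (half-up Y)
      j = Z ∸ i

      Y≤2i : Y ≤ 2 * i
      Y≤2i = proj₁ (proj₂ (half-up Y))

      2i≤1+Y : 2 * i ≤ suc Y
      2i≤1+Y = proj₂ (proj₂ (half-up Y))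

      i≤Z : i ≤ Z
      i≤Z = *-cancelˡ-≤ 2 (≤-trans 2i≤1+Y Y<2Z)

      i+j≡Z : i + j ≡ Z
      i+j≡Z = m+[n∸m]≡n i≤Z

      -- m^(Y + 2j) ≤ m^2Z ≤ c^Z ≤ 2 m^(Y + N), and 2 < m.
      2j≤N : 2 * j ≤ N
      2j≤N = s≤s⁻¹ (^-cancelʳ-< (2 * j) (suc N) 1≤m (begin-strict
        m ^ (2 * j)       ≤⟨ *-cancelˡ-≤ (m ^ Y) {{m^n≢0 m Y}} le ⟩
        2 * m ^ N         <⟨ *-monoˡ-< (m ^ N) {{m^n≢0 m N}} 2<m ⟩
        m ^ suc N         ∎))
        where
        swap : ∀ u v → 2 * (u * v) ≡ u * (2 * v)
        swap = solve-∀
        lemma : ∀ i j → 2 * i + 2 * j ≡ 2 * (i + j)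
        lemma = solve-∀
        le : m ^ Y * m ^ (2 * j) ≤ m ^ Y * (2 * m ^ N)
        le = begin
          m ^ Y * m ^ (2 * j)         ≤⟨ *-monoˡ-≤ (m ^ (2 * j)) (^-monoʳ 1≤m Y≤2i) ⟩
          m ^ (2 * i) * m ^ (2 * j)   ≡⟨ ^-distribˡ-+-* m (2 * i) (2 * j) ⟨
          m ^ (2 * i + 2 * j)         ≡⟨ cong (m ^_) (trans (lemma i j) (cong (2 *_) i+j≡Z)) ⟩
          m ^ (2 * Z)                 ≡⟨ m^2[ Z ] ⟨
          (m * m) ^ Z                 ≤⟨ ^-monoˡ-≤ Z m²≤c ⟩
          C                           ≤⟨ C≤2m^Y*m^N ⟩
          2 * (m ^ Y * m ^ N)         ≡⟨ swap (m ^ Y) (m ^ N) ⟩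
          m ^ Y * (2 * m ^ N)         ∎

      2[Zy]^1+j<m : 2 * (Z * y) ^ suc j < m
      2[Zy]^1+j<m = begin-strict
        2 * (Z * y) ^ suc j
          ≤⟨ *-monoʳ-≤ 2 (^-monoˡ-≤ (suc j) (*-mono-≤ (<⇒≤ Z<2^λ) n²≤2^2[k+1])) ⟩
        2 * (2 ^ λ₀ * 2 ^ (2 * suc k)) ^ suc j
          ≡⟨ cong (λ u → 2 * u ^ suc j) (^-distribˡ-+-* 2 λ₀ (2 * suc k)) ⟨
        2 * (2 ^ (λ₀ + 2 * suc k)) ^ suc j
          ≡⟨ cong (2 *_) (^-*-assoc 2 (λ₀ + 2 * suc k) (suc j)) ⟩
        2 ^ (1 + (λ₀ + 2 * suc k) * suc j)
          <⟨ ^-monoʳ-< 2 ≤-refl (n<1+n (1 + (λ₀ + 2 * suc k) * suc j)) ⟩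
        2 ^ (2 + (λ₀ + 2 * suc k) * suc j)
          ≤⟨ ^-monoʳ 1≤2 (tail-margin j 2j≤N) ⟩
        2 ^ M   ≤⟨ 2^M≤m ⟩
        m       ∎

      c^i≤2x^i : c ^ i ≤ 2 * x ^ i
      c^i≤2x^i = [p+q]^z≤2p^z x y i 1≤x (begin
        2 * i * y       ≤⟨ ≤-by (6 * (i * y)) (lemma i y) ⟩
        i * y * 8       ≤⟨ z*8n²≤m {i} (≤-trans i≤Z (<⇒≤ Z<2^λ)) ⟩
        m               ≤⟨ m≤m² ⟩
        x               ∎)
        where
        lemma : ∀ i y → 2 * i * y + 6 * (i * y) ≡ i * y * 8
        lemma = solve-∀

      no-solution : ⊥
      -- The exponents i and j + 1 sum to Z + 1, so every term falls on one side; since j + 1 ≥ 1,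
      -- the remainder is a multiple of y and hence of n.
      no-solution = conclude (binomial-tail-+ x y i j i+j≡Z)
        where
        conclude : ∃[ Q ] ∃[ R ] (x + y) ^ Z ≡ x ^ i * Q + y ^ suc j * R
                               × x * R ≤ Z ^ suc j * (x + y) ^ i → ⊥
        conclude (Q , R , expansion , x*R≤) =
          <⇒≱ 2≤n (≤-reflexive (coprime-a^ (2 * X) coprime-a-n (∣-trans n∣q q∣a^2X , ∣-refl)))
          where
          r : ℕ
          r = y ^ suc j * R
          shuffle₁ : ∀ x u R → x * (u * R) ≡ u * (x * R)
          shuffle₁ = solve-∀
          shuffle₂ : ∀ u z c → u * (z * c) ≡ z * u * c
          shuffle₂ = solve-∀
          shuffle₃ : ∀ s m M → s * (2 * (m * M)) ≡ 2 * s * (m * M)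
          shuffle₃ = solve-∀
          -- x r ≤ 2 (Zy)^(j + 1) m^2i with 2i ≤ Y + 1: one factor m of x pays for the rounding of
          -- i, the other exceeds 2 (Zy)^(j + 1).
          r<m^Y : r < m ^ Y
          r<m^Y = ≰⇒> λ m^Y≤r → <⇒≱ 2[Zy]^1+j<m (*-cancelʳ-≤ m (2 * (Z * y) ^ suc j) (m * m ^ Y)
            {{m*n≢0 m (m ^ Y) {{m≢0}} {{m^n≢0 m Y}}}} (begin
              m * (m * m ^ Y)                     ≡⟨ *-assoc m m (m ^ Y) ⟨
              x * m ^ Y                           ≤⟨ *-monoʳ-≤ x m^Y≤r ⟩
              x * (y ^ suc j * R)                 ≡⟨ shuffle₁ x (y ^ suc j) R ⟩
              y ^ suc j * (x * R)                 ≤⟨ *-monoʳ-≤ (y ^ suc j) x*R≤ ⟩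
              y ^ suc j * (Z ^ suc j * c ^ i)     ≡⟨ shuffle₂ (y ^ suc j) (Z ^ suc j) (c ^ i) ⟩
              Z ^ suc j * y ^ suc j * c ^ i       ≡⟨ cong (_* c ^ i) (^-distribʳ-* (suc j) Z y) ⟨
              (Z * y) ^ suc j * c ^ i             ≤⟨ *-monoʳ-≤ ((Z * y) ^ suc j) c^i≤2x^i ⟩
              (Z * y) ^ suc j * (2 * x ^ i)       ≤⟨ *-monoʳ-≤ ((Z * y) ^ suc j) (*-monoʳ-≤ 2
                                                       (≤-trans (≤-reflexive m^2[ i ]) (^-monoʳ 1≤m 2i≤1+Y))) ⟩
              (Z * y) ^ suc j * (2 * (m * m ^ Y)) ≡⟨ shuffle₃ ((Z * y) ^ suc j) m (m ^ Y) ⟩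
              2 * (Z * y) ^ suc j * (m * m ^ Y)   ∎))
          m^Y∣ : m ^ Y ∣ x ^ i * Q
          m^Y∣ = ∣m⇒∣m*n Q (subst (m ^ Y ∣_) (sym m^2[ i ]) (^-monoʳ-∣ m Y≤2i))
          q≡r : q ≡ r
          q≡r = ≡-from-mod (m ^ Y) q r ((2 * n) ^ Y) (quotient m^Y∣) q<m^Y r<m^Y (begin-equality
            q + m ^ Y * (2 * n) ^ Y        ≡⟨ cong (q +_) B≡ ⟨
            q + B                          ≡⟨ q+B≡C ⟩
            (x + y) ^ Z                    ≡⟨ expansion ⟩
            x ^ i * Q + r                  ≡⟨ cong (_+ r) (m∣n⇒n≡m*quotient m^Y∣) ⟩
            m ^ Y * quotient m^Y∣ + r      ∎)
          n∣q : n ∣ q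
          n∣q = subst (n ∣_) (sym q≡r) (∣m⇒∣m*n R (∣m⇒∣m*n (y ^ j) (m∣m*n n)))
          q∣a^2X : q ∣ a ^ (2 * X)
          q∣a^2X = subst (q ∣_) factored (n∣m*n (q + 2 * B))

    Y≡1 : Y ≡ 1
    Y≡1 = ≤-antisym (≮⇒≥ no-solution) 1≤Y

    Z≡1 : Z ≡ 1
    Z≡1 = ≤-antisym (s≤s⁻¹ (subst (λ Y → Z < 2 * Y) Y≡1 Z<2Y)) 1≤Z

    X≡1 : X ≡ 1
    X≡1 = ≤-antisym (subst (X ≤_) Z≡1 X≤Z) 1≤X

-- Lower bounds for the elements of the cuts

/-mono-≤ : ∀ a d b e → a ℕ.* suc e ℕ.≤ b ℕ.* suc d → pos a / suc d ℚ.≤ pos b / suc e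
/-mono-≤ a d b e le = ℚP.toℚᵘ-cancel-≤
  (ℚᵘP.≤-respˡ-≃ (ℚᵘP.≃-sym (ℚP.toℚᵘ-fromℚᵘ (mkℚᵘ (pos a) d)))
  (ℚᵘP.≤-respʳ-≃ (ℚᵘP.≃-sym (ℚP.toℚᵘ-fromℚᵘ (mkℚᵘ (pos b) e)))
    (*≤* (subst₂ ℤ._≤_ (ℤP.pos-* a (suc e)) (ℤP.pos-* b (suc d)) (ℤ.+≤+ le)))))

/-mono-< : ∀ a d b e → a ℕ.* suc e ℕ.< b ℕ.* suc d → pos a / suc d ℚ.< pos b / suc e
/-mono-< a d b e lt = ℚP.toℚᵘ-cancel-<
  (ℚᵘP.<-respˡ-≃ (ℚᵘP.≃-sym (ℚP.toℚᵘ-fromℚᵘ (mkℚᵘ (pos a) d)))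
  (ℚᵘP.<-respʳ-≃ (ℚᵘP.≃-sym (ℚP.toℚᵘ-fromℚᵘ (mkℚᵘ (pos b) e)))
    (*<* (subst₂ ℤ._<_ (ℤP.pos-* a (suc e)) (ℤP.pos-* b (suc d)) (ℤ.+<+ lt)))))

⟦_⟧ : ℕ → ℚ
⟦ a ⟧ = pos a / 1

⟦⟧-mono-≤ : ∀ {a b} → a ℕ.≤ b → ⟦ a ⟧ ℚ.≤ ⟦ b ⟧
⟦⟧-mono-≤ {a} {b} a≤b = /-mono-≤ a 0 b 0 (ℕP.*-monoˡ-≤ 1 a≤b)

⟦⟧-mono-< : ∀ {a b} → a ℕ.< b → ⟦ a ⟧ ℚ.< ⟦ b ⟧
⟦⟧-mono-< {a} {b} a<b = /-mono-< a 0 b 0 (ℕP.*-monoˡ-< 1 a<b)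

0≤⟦⟧ : ∀ a → 0ℚ ℚ.≤ ⟦ a ⟧
0≤⟦⟧ a = 0≤+/ a 1

⟦⟧-* : ∀ a b → ⟦ a ℕ.* b ⟧ ≡ ⟦ a ⟧ ℚ.* ⟦ b ⟧
⟦⟧-* a b = ℚP.toℚᵘ-injective (ℚᵘP.≃-trans (ℚP.toℚᵘ-fromℚᵘ (mkℚᵘ (pos (a ℕ.* b)) 0))
  (ℚᵘP.≃-trans (*≡* (cong (ℤ._* pos 1) (ℤP.pos-* a b)))
  (ℚᵘP.≃-sym (ℚᵘP.≃-trans (ℚP.toℚᵘ-homo-* ⟦ a ⟧ ⟦ b ⟧)
    (ℚᵘP.*-cong (ℚP.toℚᵘ-fromℚᵘ (mkℚᵘ (pos a) 0)) (ℚP.toℚᵘ-fromℚᵘ (mkℚᵘ (pos b) 0)))))))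

⟦⟧-^ : ∀ a e → ⟦ a ℕ.^ e ⟧ ≡ ⟦ a ⟧ ^ℚ e
⟦⟧-^ a zero    = refl
⟦⟧-^ a (suc e) = trans (⟦⟧-* a (a ℕ.^ e)) (cong (⟦ a ⟧ ℚ.*_) (⟦⟧-^ a e))

^ℚ-mono-≤ : ∀ {x y} → 0ℚ ℚ.≤ x → x ℚ.≤ y → ∀ e → x ^ℚ e ℚ.≤ y ^ℚ e
^ℚ-mono-≤ 0≤x x≤y zero    = ℚP.≤-refl
^ℚ-mono-≤ {x} {y} 0≤x x≤y (suc e) = ℚP.≤-trans
  (ℚP.*-monoˡ-≤-nonNeg x {{nonNegative 0≤x}} (^ℚ-mono-≤ 0≤x x≤y e))
  (ℚP.*-monoʳ-≤-nonNeg (y ^ℚ e) {{nonNegative (0≤^ℚ (ℚP.≤-trans 0≤x x≤y) e)}} x≤y)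

0<^ℚ : ∀ {y} → 0ℚ ℚ.< y → ∀ e → 0ℚ ℚ.< y ^ℚ e
0<^ℚ 0<y zero = ℚP.positive⁻¹ 1ℚ
0<^ℚ {y} 0<y (suc e) = ℚP.positive⁻¹ (y ℚ.* y ^ℚ e)
  {{ℚP.pos*pos⇒pos y {{positive 0<y}} (y ^ℚ e) {{positive (0<^ℚ 0<y e)}}}}

^ℚ-mono-< : ∀ {x y} → 0ℚ ℚ.≤ x → x ℚ.< y → ∀ e → x ^ℚ suc e ℚ.< y ^ℚ suc e
^ℚ-mono-< {x} {y} 0≤x x<y e = ℚP.≤-<-trans
  (ℚP.*-monoˡ-≤-nonNeg x {{nonNegative 0≤x}} (^ℚ-mono-≤ 0≤x (ℚP.<⇒≤ x<y) e))
  (ℚP.*-monoˡ-<-pos (y ^ℚ e) {{positive (0<^ℚ (ℚP.≤-<-trans 0≤x x<y) e)}} x<y)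

^ℚ-cancel-≤ : ∀ {x y} → 0ℚ ℚ.≤ y → ∀ e → x ^ℚ suc e ℚ.≤ y ^ℚ suc e → x ℚ.≤ y
^ℚ-cancel-≤ 0≤y e le = ℚP.≮⇒≥ λ y<x → ℚP.<-irrefl refl (ℚP.<-≤-trans (^ℚ-mono-< 0≤y y<x e) le)

/-+ : ∀ a b d → pos (a ℕ.+ b) / suc d ≡ pos a / suc d ℚ.+ pos b / suc d
/-+ a b d = ℚP.toℚᵘ-injective (ℚᵘP.≃-trans (ℚP.toℚᵘ-fromℚᵘ (mkℚᵘ (pos (a ℕ.+ b)) d))
  (ℚᵘP.≃-trans (*≡* eq)
  (ℚᵘP.≃-sym (ℚᵘP.≃-trans (ℚP.toℚᵘ-homo-+ (pos a / suc d) (pos b / suc d))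
    (ℚᵘP.+-cong (ℚP.toℚᵘ-fromℚᵘ (mkℚᵘ (pos a) d)) (ℚP.toℚᵘ-fromℚᵘ (mkℚᵘ (pos b) d)))))))
  where
  lemma : ∀ a b D → (a ℕ.+ b) ℕ.* (D ℕ.* D) ≡ (a ℕ.* D ℕ.+ b ℕ.* D) ℕ.* D
  lemma = solve-∀
  D : ℕ
  D = suc d
  eq : pos (a ℕ.+ b) ℤ.* pos (D ℕ.* D) ≡ (pos a ℤ.* pos D ℤ.+ pos b ℤ.* pos D) ℤ.* pos D
  eq = trans (sym (ℤP.pos-* (a ℕ.+ b) (D ℕ.* D))) (trans (cong pos (lemma a b D))
    (trans (ℤP.pos-* (a ℕ.* D ℕ.+ b ℕ.* D) D) (cong (ℤ._* pos D)
      (cong₂ ℤ._+_ (ℤP.pos-* a D) (ℤP.pos-* b D)))))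

-- Harmonic sums and a lower bound for the logarithm

harmonic : (len s : ℕ) → ℚ
harmonic zero      s = 0ℚ
harmonic (suc len) s = pos 1 / suc s ℚ.+ harmonic len (suc s)

∑≡harmonic : ∀ {len} (f : Fin len → ℚ) s → (∀ i → f i ≡ pos 1 / suc (s ℕ.+ toℕ i)) → ∑ f ≡ harmonic len s
∑≡harmonic {zero}    f s f≡ = refl
∑≡harmonic {suc len} f s f≡ = cong₂ ℚ._+_
  (trans (f≡ fzero) (cong (λ t → pos 1 / suc t) (ℕP.+-identityʳ s)))
  (∑≡harmonic (λ i → f (fsuc i)) (suc s)
    (λ i → trans (f≡ (fsuc i)) (cong (λ t → pos 1 / suc t) (ℕP.+-suc s (toℕ i)))))

0≤harmonic : ∀ len s → 0ℚ ℚ.≤ harmonic len s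
0≤harmonic zero      s = ℚP.≤-refl
0≤harmonic (suc len) s = ℚP.+-mono-≤ (0≤+/ 1 (suc s)) (0≤harmonic len (suc s))

-- The denominators of the first j terms are at most s + j ≤ suc d.
harmonic-split : ∀ j len s d → s ℕ.+ j ℕ.≤ suc d →
  pos j / suc d ℚ.+ harmonic len (s ℕ.+ j) ℚ.≤ harmonic (j ℕ.+ len) s
harmonic-split zero    len s d _  = begin
  pos 0 / suc d ℚ.+ harmonic len (s ℕ.+ 0)
    ≤⟨ ℚP.+-mono-≤ (/-mono-≤ 0 d 0 0 z≤n)
         (ℚP.≤-reflexive (cong (harmonic len) (ℕP.+-identityʳ s))) ⟩
  0ℚ ℚ.+ harmonic len s                  ≡⟨ ℚP.+-identityˡ _ ⟩
  harmonic len s                         ∎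
  where open ℚP.≤-Reasoning
harmonic-split (suc j) len s d le = begin
  pos (suc j) / suc d ℚ.+ harmonic len (s ℕ.+ suc j)
    ≡⟨ cong₂ ℚ._+_ (/-+ 1 j d) (cong (harmonic len) (ℕP.+-suc s j)) ⟩
  (pos 1 / suc d ℚ.+ pos j / suc d) ℚ.+ harmonic len (suc s ℕ.+ j)
    ≡⟨ ℚP.+-assoc (pos 1 / suc d) (pos j / suc d) (harmonic len (suc s ℕ.+ j)) ⟩
  pos 1 / suc d ℚ.+ (pos j / suc d ℚ.+ harmonic len (suc s ℕ.+ j))
    ≤⟨ ℚP.+-mono-≤ (/-mono-≤ 1 d 1 s (ℕP.+-monoˡ-≤ 0 s<d))
         (harmonic-split j len (suc s) d (subst (ℕ._≤ suc d) (ℕP.+-suc s j) le)) ⟩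
  pos 1 / suc s ℚ.+ harmonic (j ℕ.+ len) (suc s) ∎
  where
  open ℚP.≤-Reasoning
  s<d : suc s ℕ.≤ suc d
  s<d = ℕP.≤-trans (ℕP.≤-trans (s≤s (ℕP.m≤m+n s j)) (ℕP.≤-reflexive (sym (ℕP.+-suc s j)))) le

-- The suc s terms split off have denominators s + 1 to 2s + 1, so each exceeds 1 / (2s + 2). The
-- rest starts at twice the old first denominator.
½+harmonic≤ : ∀ len s → ½ ℚ.+ harmonic len (s ℕ.+ suc s) ℚ.≤ harmonic (suc s ℕ.+ len) s
½+harmonic≤ len s = ℚP.≤-trans
  (ℚP.+-monoˡ-≤ (harmonic len (s ℕ.+ suc s))
    (/-mono-≤ 1 1 (suc s) (s ℕ.+ suc s) (ℕP.≤-reflexive (lemma s))))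
  (harmonic-split (suc s) len s (s ℕ.+ suc s) (ℕP.n≤1+n _))
  where
  lemma : ∀ s → 1 ℕ.* (1 ℕ.+ (s ℕ.+ (1 ℕ.+ s))) ≡ (1 ℕ.+ s) ℕ.* 2
  lemma = solve-∀

3s≤len : ∀ h len s → 4 ℕ.^ suc h ℕ.* suc s ℕ.≤ len ℕ.+ suc s → suc s ℕ.+ 2 ℕ.* suc s ℕ.≤ len
3s≤len h len s le = ℕP.+-cancelʳ-≤ (suc s) _ len (begin
  suc s ℕ.+ 2 ℕ.* suc s ℕ.+ suc s    ≡⟨ lemma (suc s) ⟩
  4 ℕ.* 1 ℕ.* suc s                  ≤⟨ ℕP.*-monoˡ-≤ (suc s) (ℕP.*-monoʳ-≤ 4 (ℕP.m^n>0 4 h)) ⟩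
  4 ℕ.^ suc h ℕ.* suc s              ≤⟨ le ⟩
  len ℕ.+ suc s                      ∎)
  where
  open ℕP.≤-Reasoning
  lemma : ∀ u → u ℕ.+ 2 ℕ.* u ℕ.+ u ≡ 4 ℕ.* 1 ℕ.* u
  lemma = solve-∀

-- Oresme's argument: each doubling of the first denominator gains ½, so a factor 4 gains 1. In a
-- Darboux sum for log n the endpoint len + suc s is n times suc s, so the bound holds for every
-- mesh once 4^h ≤ n.
h≤harmonic : ∀ h len s → 4 ℕ.^ h ℕ.* suc s ℕ.≤ len ℕ.+ suc s → ⟦ h ⟧ ℚ.≤ harmonic len s
h≤harmonic zero    len s _  = 0≤harmonic len s
h≤harmonic (suc h) len s le with ℕP.m≤n⇒∃[o]m+o≡n (3s≤len h len s le)
... | o , refl = begin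
  ⟦ 1 ℕ.+ h ⟧                              ≡⟨ /-+ 1 h 0 ⟩
  1ℚ ℚ.+ ⟦ h ⟧                             ≤⟨ ℚP.+-monoʳ-≤ 1ℚ (h≤harmonic h o s″ rest) ⟩
  (½ ℚ.+ ½) ℚ.+ harmonic o s″              ≡⟨ ℚP.+-assoc ½ ½ (harmonic o s″) ⟩
  ½ ℚ.+ (½ ℚ.+ harmonic o s″)              ≤⟨ ℚP.+-monoʳ-≤ ½ (½+harmonic≤ o s′) ⟩
  ½ ℚ.+ harmonic (suc s′ ℕ.+ o) s′         ≤⟨ ½+harmonic≤ (suc s′ ℕ.+ o) s ⟩
  harmonic (suc s ℕ.+ (suc s′ ℕ.+ o)) s    ≡⟨ cong (λ t → harmonic t s) (regroup s o) ⟩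
  harmonic (suc s ℕ.+ 2 ℕ.* suc s ℕ.+ o) s ∎
  where
  open ℚP.≤-Reasoning
  s′ s″ : ℕ
  s′ = s ℕ.+ suc s
  s″ = s′ ℕ.+ suc s′
  regroup : ∀ s o → 1 ℕ.+ s ℕ.+ (1 ℕ.+ (s ℕ.+ (1 ℕ.+ s)) ℕ.+ o) ≡ 1 ℕ.+ s ℕ.+ 2 ℕ.* (1 ℕ.+ s) ℕ.+ o
  regroup = solve-∀
  scale : ∀ p s → p ℕ.* (1 ℕ.+ (s ℕ.+ (1 ℕ.+ s) ℕ.+ (1 ℕ.+ (s ℕ.+ (1 ℕ.+ s))))) ≡ 4 ℕ.* p ℕ.* (1 ℕ.+ s)
  scale = solve-∀
  move : ∀ s o → 1 ℕ.+ s ℕ.+ 2 ℕ.* (1 ℕ.+ s) ℕ.+ o ℕ.+ (1 ℕ.+ s) ≡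
    o ℕ.+ (1 ℕ.+ (s ℕ.+ (1 ℕ.+ s) ℕ.+ (1 ℕ.+ (s ℕ.+ (1 ℕ.+ s)))))
  move = solve-∀
  rest : 4 ℕ.^ h ℕ.* suc s″ ℕ.≤ o ℕ.+ suc s″
  rest = subst₂ ℕ._≤_ (sym (scale (4 ℕ.^ h) s)) (move s o) le

h<log : ∀ {n} .{{_ : NonZero n}} h → 4 ℕ.^ h ℕ.≤ n → ∀ {v} → upper (log n) v → ⟦ h ⟧ ℚ.< v
h<log {n@(suc n-1)} h 4^h≤n {v} (_ , (l , refl) , d<v) = ℚP.≤-<-trans (begin
  ⟦ h ⟧                        ≤⟨ h≤harmonic h (n-1 ℕ.* suc l) l
      (ℕP.≤-trans (ℕP.*-monoˡ-≤ (suc l) 4^h≤n) (ℕP.≤-reflexive (ℕP.+-comm (suc l) (n-1 ℕ.* suc l)))) ⟩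
  harmonic (n-1 ℕ.* suc l) l   ≡⟨ ∑≡harmonic {n-1 ℕ.* suc l} _ l (λ _ → refl) ⟨
  darboux n l                  ∎) d<v
  where open ℚP.≤-Reasoning

-- Compared after squaring: r² ≤ h³ ≤ u³ ≤ s².
r<x^⟨3/2⟩ : ∀ {x h r} → r ℕ.^ 2 ℕ.≤ h ℕ.^ 3 → (∀ {v} → upper x v → ⟦ h ⟧ ℚ.< v) →
  ∀ {t} → upper (x ^⟨ 3 / 2 ⟩) t → ⟦ r ⟧ ℚ.< t
r<x^⟨3/2⟩ {x} {h} {r} r²≤h³ h<x {t} (s , (0≤s , u , u∈x , u³≤s²) , s<t) =
  ℚP.≤-<-trans (^ℚ-cancel-≤ 0≤s 1 (begin
    ⟦ r ⟧ ^ℚ 2    ≡⟨ ⟦⟧-^ r 2 ⟨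
    ⟦ r ℕ.^ 2 ⟧   ≤⟨ ⟦⟧-mono-≤ r²≤h³ ⟩
    ⟦ h ℕ.^ 3 ⟧   ≡⟨ ⟦⟧-^ h 3 ⟩
    ⟦ h ⟧ ^ℚ 3    ≤⟨ ^ℚ-mono-≤ (0≤⟦⟧ h) (ℚP.<⇒≤ (h<x u∈x)) 3 ⟩
    u ^ℚ 3        ≤⟨ u³≤s² ⟩
    s ^ℚ 2        ∎)) s<t
  where open ℚP.≤-Reasoning

-- A fraction p / q above σ is above r, so n^(rq) ≤ n^p ≤ u^p ≤ s′^q, and q-th roots are taken.
n^r<n^ℝ : ∀ {n} .{{_ : NonZero n}} {σ r} → (∀ {t} → upper σ t → ⟦ r ⟧ ℚ.< t) →
  ∀ {t} → upper (n ^ℝ σ) t → ⟦ n ℕ.^ r ⟧ ℚ.< t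
n^r<n^ℝ {n} {σ} {r} r<σ {t}
  (s , (p , q-1 , p/q∈σ , s′ , (0≤s′ , u , (_ , refl , n<u) , u^p≤s′^q) , s′<s) , s<t) =
  ℚP.≤-<-trans (^ℚ-cancel-≤ 0≤s′ q-1 (begin
    ⟦ n ℕ.^ r ⟧ ^ℚ suc q-1       ≡⟨ ⟦⟧-^ (n ℕ.^ r) (suc q-1) ⟨
    ⟦ (n ℕ.^ r) ℕ.^ suc q-1 ⟧    ≡⟨ cong ⟦_⟧ (ℕP.^-*-assoc n r (suc q-1)) ⟩
    ⟦ n ℕ.^ (r ℕ.* suc q-1) ⟧    ≤⟨ ⟦⟧-mono-≤ (ℕP.^-monoʳ-≤ n rq≤p) ⟩
    ⟦ n ℕ.^ p ⟧                  ≡⟨ ⟦⟧-^ n p ⟩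
    ⟦ n ⟧ ^ℚ p                   ≤⟨ ^ℚ-mono-≤ (0≤⟦⟧ n) (ℚP.<⇒≤ n<u) p ⟩
    u ^ℚ p                       ≤⟨ u^p≤s′^q ⟩
    s′ ^ℚ suc q-1                ∎)) (ℚP.<-trans s′<s s<t)
  where
  open ℚP.≤-Reasoning
  rq≤p : r ℕ.* suc q-1 ℕ.≤ p
  rq≤p = ℕP.≮⇒≥ λ p<rq → ℚP.<-irrefl refl (ℚP.<-≤-trans (r<σ p/q∈σ) (/-mono-≤ p q-1 r 0
    (subst (ℕ._≤ r ℕ.* suc q-1) (sym (ℕP.*-identityʳ p)) (ℕP.<⇒≤ p<rq))))

⟦⟧<⇒≤ : ∀ {e m Q} → ⟦ e ⟧ ℚ.< Q → (∀ {r} → upper (fromℕ m) r → Q ℚ.< r) → e ℕ.≤ m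
⟦⟧<⇒≤ {e} {m} {Q} e<Q Q<m = ℕP.≮⇒≥ λ m<e →
  ℚP.<-irrefl refl (Q<m (⟦ m ⟧ , refl , ℚP.<-trans (⟦⟧-mono-< m<e) e<Q))

-- Translates the real hypothesis into natural numbers: 4^h ≤ n puts h below log n, and r ≤ h^(3/2)
-- is written r² ≤ h³.
threshold : ∀ K m n .{{_ : NonZero n}} → (fromℕ K ⊔ℝ n ^ℝ (log n ^⟨ 3 / 2 ⟩)) <ℝ fromℕ m →
  K ℕ.≤ m × (∀ h r → 4 ℕ.^ h ℕ.≤ n → r ℕ.^ 2 ℕ.≤ h ℕ.^ 3 → n ℕ.^ r ℕ.≤ m)
threshold K m n (Q , ((_ , refl , K<Q) , Q∈) , Q<m) = ⟦⟧<⇒≤ {m = m} K<Q Q<m ,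
  λ h r 4^h≤n r²≤h³ → ⟦⟧<⇒≤ {m = m} (n^r<n^ℝ {n} {log n ^⟨ 3 / 2 ⟩} {r}
    (r<x^⟨3/2⟩ {log n} {h} {r} r²≤h³ (h<log {n} h 4^h≤n)) Q∈) Q<m

-- Parities, and the hypotheses in terms of binary logarithms

2∤odd : ∀ {x} → 2 ∣ x → ¬ (∃[ s ] x ≡ 1 + 2 * s)
2∤odd 2∣x (s , refl) with coprime-2-odd s (∣-refl , 2∣x)
... | ()

parities : ∀ {m n} → m % 2 ≢ n % 2 →
  (2 ∣ m × ∃[ s ] n ≡ 1 + 2 * s) ⊎ (2 ∣ n × ∃[ s ] m ≡ 1 + 2 * s)
parities {m} {n} ≢ with even-or-odd m | even-or-odd n
... | inj₁ (s , refl) | inj₂ odd-n      = inj₁ (m∣m*n s , odd-n)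
... | inj₂ odd-m      | inj₁ (t , refl) = inj₂ (m∣m*n t , odd-m)
... | inj₁ (s , refl) | inj₁ (t , refl) = ⊥-elim (≢ (trans (2*%2 s) (sym (2*%2 t))))
  where
  2*%2 : ∀ s → 2 * s % 2 ≡ 0
  2*%2 s = trans (cong (_% 2) (*-comm 2 s)) (m*n%n≡0 s 2)
... | inj₂ (s , refl) | inj₂ (t , refl) = ⊥-elim (≢ (trans (1+2*%2 s) (sym (1+2*%2 t))))
  where
  1+2*%2 : ∀ s → (1 + 2 * s) % 2 ≡ 1
  1+2*%2 s = trans (cong (λ u → (1 + u) % 2) (*-comm 2 s)) ([m+kn]%n≡m%n 1 s 2)

odd-difference-of-squares : ∀ {a m n} → m % 2 ≢ n % 2 → a + n * n ≡ m * m → ∃[ s ] a ≡ 1 + 2 * s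
odd-difference-of-squares {a} {m} {n} m≢n eq with even-or-odd a | parities {m} {n} m≢n
... | inj₂ odd-a      | _ = odd-a
... | inj₁ (s , refl) | inj₁ (2∣m , odd-n) =
  ⊥-elim (2∤odd (∣m+n∣m⇒∣n (subst (2 ∣_) (sym eq) (∣m⇒∣m*n m 2∣m)) (m∣m*n s)) (odd-* odd-n odd-n))
... | inj₁ (s , refl) | inj₂ (2∣n , odd-m) =
  ⊥-elim (2∤odd (subst (2 ∣_) eq (∣m∣n⇒∣m+n (m∣m*n s) (∣m⇒∣m*n n 2∣n))) (odd-* odd-m odd-m))

2∣product : ∀ {m n} → m % 2 ≢ n % 2 → 2 ∣ m * n
2∣product {m} {n} m≢n with parities {m} {n} m≢n
... | inj₁ (2∣m , _) = ∣m⇒∣m*n n 2∣m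
... | inj₂ (2∣n , _) = ∣n⇒∣m*n m 2∣n

2e≤M : ∀ {e E m M} → e ≤ E → 10 ^ E ≤ m → m < 2 ^ suc M → 2 * e ≤ M
2e≤M {e} {E} {m} {M} e≤E 10^E≤m m<2^M+1 = s≤s⁻¹ (^-cancelʳ-< (2 * e) (suc M) 1≤2 (begin-strict
  2 ^ (2 * e)    ≡⟨ ^-*-assoc 2 2 e ⟨
  4 ^ e          ≤⟨ ^-monoˡ-≤ e (≤ᵇ⇒≤ 4 10 tt) ⟩
  10 ^ e         ≤⟨ ^-monoʳ (≤ᵇ⇒≤ 1 10 tt) e≤E ⟩
  10 ^ E         ≤⟨ 10^E≤m ⟩
  m              <⟨ m<2^M+1 ⟩
  2 ^ suc M      ∎))
  where open ≤-Reasoning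

half-down : ∀ k → ∃[ h ] 2 * h ≤ k × k ≤ 1 + 2 * h
half-down k with even-or-odd k
... | inj₁ (h , refl) = h , ≤-refl , n≤1+n _
... | inj₂ (h , refl) = h , n≤1+n _ , ≤-refl

-- Take h = k / 2 rounded down and r = 4k. Then 4^h ≤ 2^k ≤ n, and k ≥ 200 gives h ≥ 99, whence r² ≤
-- (9h)² = 81h² ≤ h³. So m ≥ n^r ≥ 2^(4k²).
4k²≤M-large : ∀ {k M m n} .{{_ : NonZero n}} → 200 ≤ k → 2 ^ k ≤ n → m < 2 ^ suc M →
  (∀ h r → 4 ^ h ≤ n → r ^ 2 ≤ h ^ 3 → n ^ r ≤ m) → 4 * (k * k) ≤ M
4k²≤M-large {k} {M} {m} {n} 200≤k 2^k≤n m<2^M+1 n^r≤m = go (half-down k)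
  where
  open ≤-Reasoning
  go : ∃[ h ] 2 * h ≤ k × k ≤ 1 + 2 * h → 4 * (k * k) ≤ M
  go (h , 2h≤k , k≤1+2h) = s≤s⁻¹ (^-cancelʳ-< (4 * (k * k)) (suc M) 1≤2 (begin-strict
    2 ^ (4 * (k * k))    ≡⟨ cong (2 ^_) (lemma k) ⟩
    2 ^ (k * (4 * k))    ≡⟨ ^-*-assoc 2 k (4 * k) ⟨
    (2 ^ k) ^ (4 * k)    ≤⟨ ^-monoˡ-≤ (4 * k) 2^k≤n ⟩
    n ^ (4 * k)          ≤⟨ n^r≤m h (4 * k) 4^h≤n r²≤h³ ⟩
    m                    <⟨ m<2^M+1 ⟩
    2 ^ suc M            ∎))
    where
    lemma : ∀ k → 4 * (k * k) ≡ k * (4 * k)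
    lemma = solve-∀
    99≤h : 99 ≤ h
    99≤h = *-cancelˡ-≤ 2 (s≤s⁻¹ (≤-trans (≤ᵇ⇒≤ 199 200 tt) (≤-trans 200≤k k≤1+2h)))
    4^h≤n : 4 ^ h ≤ n
    4^h≤n = ≤-trans (≤-reflexive (^-*-assoc 2 2 h)) (≤-trans (^-monoʳ 1≤2 2h≤k) 2^k≤n)
    expand : ∀ h → 4 * (1 + 2 * h) ≡ 8 * h + 4
    expand = solve-∀
    nine : ∀ h → 8 * h + h ≡ 9 * h
    nine = solve-∀
    4k≤9h : 4 * k ≤ 9 * h
    4k≤9h = begin
      4 * k            ≤⟨ *-monoʳ-≤ 4 k≤1+2h ⟩
      4 * (1 + 2 * h)  ≡⟨ expand h ⟩
      8 * h + 4        ≤⟨ +-monoʳ-≤ (8 * h) (≤-trans (≤ᵇ⇒≤ 4 99 tt) 99≤h) ⟩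
      8 * h + h        ≡⟨ nine h ⟩
      9 * h            ∎
    collect : ∀ u h → (u * h) ^ 2 ≡ u * u * h ^ 2
    collect u h = lemma′ u h
      where
      lemma′ : ∀ u h → u * h * (u * h * 1) ≡ u * u * (h * (h * 1))
      lemma′ = solve-∀
    r²≤h³ : (4 * k) ^ 2 ≤ h ^ 3
    r²≤h³ = begin
      (4 * k) ^ 2      ≤⟨ ^-monoˡ-≤ 2 4k≤9h ⟩
      (9 * h) ^ 2      ≡⟨ collect 9 h ⟩
      9 * 9 * h ^ 2    ≤⟨ *-monoˡ-≤ (h ^ 2) (≤-trans (≤ᵇ⇒≤ 81 99 tt) 99≤h) ⟩
      h ^ 3            ∎

-- All that is used of the lower bound n^(log n)^(3/2) for m: log m dominates (log n)².
4k²≤M : ∀ {k M m n} .{{_ : NonZero n}} → 2 * 80000 ≤ M → 2 ^ k ≤ n → m < 2 ^ suc M →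
  (∀ h r → 4 ^ h ≤ n → r ^ 2 ≤ h ^ 3 → n ^ r ≤ m) → 4 * (k * k) ≤ M
4k²≤M {k} {M} 160000≤M 2^k≤n m<2^M+1 n^r≤m with k ≤? 200
-- 2 · 80000 = 4 · 200²: up to k = 200 the size of m alone suffices.
... | yes k≤200 = ≤-trans (*-monoʳ-≤ 4 (*-mono-≤ k≤200 k≤200))
  (≤-trans (≤ᵇ⇒≤ (4 * (200 * 200)) (2 * 80000) tt) 160000≤M)
... | no  k≰200 = 4k²≤M-large (<⇒≤ (≰⇒> k≰200)) 2^k≤n m<2^M+1 n^r≤m

exponents≡1 : ∀ {E m n a} .{{_ : NonZero n}} → 80000 ≤ E → Coprime m n → m % 2 ≢ n % 2 → a + n * n ≡ m * m →
  10 ^ E ≤ m → (∀ h r → 4 ^ h ≤ n → r ^ 2 ≤ h ^ 3 → n ^ r ≤ m) →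
  ∀ {X Y Z} → 1 ≤ X → 1 ≤ Y → 1 ≤ Z →
  a ^ (2 * X) + (2 * m * n) ^ (2 * Y) ≡ (m * m + n * n) ^ (2 * Z) → X ≡ 1 × Y ≡ 1 × Z ≡ 1
exponents≡1 {E} {m} {n} {a} 80000≤E cop m≢n a+n²≡m² 10^E≤m n^r≤m {X} {Y} {Z} 1≤X 1≤Y 1≤Z eq =
  go (floor-log₂ n 1≤n) (floor-log₂ m (≤-trans (1≤^ (≤ᵇ⇒≤ 1 10 tt) E) 10^E≤m))
  where
  1≤n : 1 ≤ n
  1≤n = n≢0⇒n>0 (≢-nonZero⁻¹ n)
  go : (∃[ k ] 2 ^ k ≤ n × n < 2 ^ suc k) → (∃[ M ] 2 ^ M ≤ m × m < 2 ^ suc M) → X ≡ 1 × Y ≡ 1 × Z ≡ 1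
  go (k , 2^k≤n , n<) (M , 2^M≤m , m<) = S.X≡1 , S.Y≡1 , S.Z≡1
    where
    160000≤M : 2 * 80000 ≤ M
    160000≤M = 2e≤M 80000≤E 10^E≤m m<
    module S = Solution a m n k M a+n²≡m² cop
      (odd-difference-of-squares {a} {m} {n} m≢n a+n²≡m²) (2∣product {m} {n} m≢n)
      1≤n n< 2^M≤m m< (4k²≤M {k} 160000≤M 2^k≤n m< n^r≤m)
      (≤-trans (≤ᵇ⇒≤ (2 ^ 16) (2 * 80000) tt) 160000≤M) X Y Z 1≤X 1≤Y 1≤Z eq

only-222 : ∀ {E m n} .{{_ : NonZero n}} → 80000 ≤ E → n < m → Coprime m n → m % 2 ≢ n % 2 →
  10 ^ E ≤ m → (∀ h r → 4 ^ h ≤ n → r ^ 2 ≤ h ^ 3 → n ^ r ≤ m) →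
  ∀ {x y z} → 0 < x → 0 < y → 0 < z → (x , y , z) ≢ (2 , 2 , 2) →
  2 ∣ x → 2 ∣ y → 2 ∣ z → (m ^ 2 ∸ n ^ 2) ^ x + (2 * m * n) ^ y ≢ (m ^ 2 + n ^ 2) ^ z
only-222 {E} {m} {n} 80000≤E n<m cop m≢n 10^E≤m n^r≤m 0<x 0<y 0<z ≢222
  (divides X refl) (divides Y refl) (divides Z refl) eq =
  conclude (exponents≡1 80000≤E cop m≢n a+n²≡m² 10^E≤m n^r≤m
    (positive-half X 0<x) (positive-half Y 0<y) (positive-half Z 0<z) halved)
  where
  sq : ∀ t → t ^ 2 ≡ t * t
  sq t = cong (t *_) (*-identityʳ t)
  a+n²≡m² : m ^ 2 ∸ n ^ 2 + n * n ≡ m * m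
  a+n²≡m² = trans (cong (m ^ 2 ∸ n ^ 2 +_) (sym (sq n)))
    (trans (m∸n+n≡m (^-monoˡ-≤ 2 (<⇒≤ n<m))) (sq m))
  positive-half : ∀ X → 0 < X * 2 → 1 ≤ X
  positive-half (suc X) _ = s≤s z≤n
  halved : (m ^ 2 ∸ n ^ 2) ^ (2 * X) + (2 * m * n) ^ (2 * Y) ≡ (m * m + n * n) ^ (2 * Z)
  halved = trans (cong₂ (λ x y → (m ^ 2 ∸ n ^ 2) ^ x + (2 * m * n) ^ y) (*-comm 2 X) (*-comm 2 Y))
    (trans eq (cong₂ _^_ (cong₂ _+_ (sq m) (sq n)) (*-comm Z 2)))
  conclude : X ≡ 1 × Y ≡ 1 × Z ≡ 1 → ⊥
  conclude (refl , refl , refl) = ≢222 refl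

theorem1p5 :
    ∀ (m n : ℕ) .{{_ : NonZero n}} →
    n < m →
    Coprime m n →
    m % 2 ≢ n % 2 →
    (fromℕ (10 ^ 109948) ⊔ℝ n ^ℝ (log n ^⟨ 3 / 2 ⟩)) <ℝ fromℕ m →
    let a = m ^ 2 ∸ n ^ 2
        b = 2 * m * n
        c = m ^ 2 + n ^ 2
    in
    ∀ (x y z : ℕ) →
    0 < x → 0 < y → 0 < z →
    (x , y , z) ≢ (2 , 2 , 2) →
    x % 2 ≡ 0 → y % 2 ≡ 0 → z % 2 ≡ 0 →
    a ^ x + b ^ y ≢ c ^ z
theorem1p5 m n n<m cop m≢n above x y z 0<x 0<y 0<z ≢222 x-even y-even z-even =
  only-222 {109948} (≤ᵇ⇒≤ 80000 109948 tt) n<m cop m≢n (proj₁ bounds) (proj₂ bounds) 0<x 0<y 0<z ≢222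
    (m%n≡0⇒n∣m x 2 x-even) (m%n≡0⇒n∣m y 2 y-even) (m%n≡0⇒n∣m z 2 z-even)
  where
  bounds : 10 ^ 109948 ≤ m × (∀ h r → 4 ^ h ≤ n → r ^ 2 ≤ h ^ 3 → n ^ r ≤ m)
  bounds = threshold (10 ^ 109948) m n above
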